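{- $\mathsf{DT}^2_{4,2}$ implies $\mathsf{ER}^2$.
   Context: Implications are in the sense of reverse mathematics over $\mathsf{RCA}_0$. $\mathsf{DT}^2_{4,2}$: for every $f:[\mathbb Q]^2\to4$ there is $S\subseteq\mathbb Q$ such that $(S,<)$ is a dense linear order without endpoints and $|f([S]^2)|\le2$. $\mathsf{ER}^2$ (Erdős–Rado theorem): for every $f:[\mathbb Q]^2\to2$ there exists $S\subseteq\mathbb Q$ such that either $S$ is infinite and $f$ is constantly $0$ on $[S]^2$, or $(S,<)$ has order type $\mathbb Q$ and $f$ is constantly $1$ on $[S]^2$. -}

module Defs where

open import Data.Fin using (Fin)
open import Data.Nat using (ℕ; zero; suc)
open import Data.Product using (Σ; _×_)
open import Data.Sum using (_⊎_)
open import Data.Vec using (Vec; _∷_; lookup)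
open import Function.Bundles using (_⇔_)
open import Relation.Binary.PropositionalEquality using (_≡_; _≢_)
open import Relation.Nullary using (¬_)
open import Relation.Nullary.Negation using (Stable)

-- The object logic is classical.  Satisfaction in a structure is therefore read
-- through the double-negation translation: atomic formulas are required to be
-- stable, ∀, →, ∧, ¬ are Agda's own, and ∃, ∨ are the following.

infixr 1 _∨_

∃ᶜ : {A : Set} → (A → Set) → Set
∃ᶜ {A} P = ¬ ¬ Σ A P

syntax ∃ᶜ (λ x → P) = ∃ᶜ[ x ] P

_∨_ : Set → Set → Set
P ∨ Q = ¬ ¬ (P ⊎ Q)

∃!ᶜ : {A : Set} → (A → Set) → Set
∃!ᶜ P = ∃ᶜ[ x ] (P x × (∀ y → P y → y ≡ x))

-- Structures for the language of second-order arithmetic with Henkin semantics: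
-- set variables range over the sort 𝒮, which need not contain every subset of N.
-- Number equality is true equality.  The stability fields hold automatically in
-- a classical metatheory.
record L₂-Structure : Set₁ where
  infixl 7 _·_
  infixl 6 _+_
  infix  4 _<_ _∈_
  field
    N   : Set
    𝒮   : Set
    0#  : N
    1#  : N
    _+_ : N → N → N
    _·_ : N → N → N
    _<_ : N → N → Set
    _∈_ : N → 𝒮 → Set
    ≡-stable : ∀ (x y : N) → Stable (x ≡ y)
    <-stable : ∀ (x y : N) → Stable (x < y)
    ∈-stable : ∀ (x : N) (X : 𝒮) → Stable (x ∈ X)

data Term (n : ℕ) : Set where
  var       : Fin n → Term n
  `0 `1     : Term n
  _`+_ _`·_ : Term n → Term n → Term n

-- Σ⁰₀ (bounded-quantifier) formulas with n free number variables and k free set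
-- variables.  A bounded quantifier binds number variable zero of its body; its
-- bounding term lives outside that scope.
data Σ⁰₀ (n k : ℕ) : Set where
  _`=_ _`<_       : Term n → Term n → Σ⁰₀ n k
  _`∈_            : Term n → Fin k → Σ⁰₀ n k
  `¬_             : Σ⁰₀ n k → Σ⁰₀ n k
  _`∧_ _`∨_ _`⇒_  : Σ⁰₀ n k → Σ⁰₀ n k → Σ⁰₀ n k
  `∀<_∙_ `∃<_∙_   : Term n → Σ⁰₀ (suc n) k → Σ⁰₀ n k

module Semantics (M : L₂-Structure) where
  open L₂-Structure M

  ⟦_⟧ᵗ : ∀ {n} → Term n → Vec N n → N
  ⟦ var i ⟧ᵗ  ρ = lookup ρ i
  ⟦ `0 ⟧ᵗ     ρ = 0#
  ⟦ `1 ⟧ᵗ     ρ = 1#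
  ⟦ s `+ t ⟧ᵗ ρ = ⟦ s ⟧ᵗ ρ + ⟦ t ⟧ᵗ ρ
  ⟦ s `· t ⟧ᵗ ρ = ⟦ s ⟧ᵗ ρ · ⟦ t ⟧ᵗ ρ

  ⟦_⟧ : ∀ {n k} → Σ⁰₀ n k → Vec N n → Vec 𝒮 k → Set
  ⟦ s `= t ⟧    ρ σ = ⟦ s ⟧ᵗ ρ ≡ ⟦ t ⟧ᵗ ρ
  ⟦ s `< t ⟧    ρ σ = ⟦ s ⟧ᵗ ρ < ⟦ t ⟧ᵗ ρ
  ⟦ t `∈ i ⟧    ρ σ = ⟦ t ⟧ᵗ ρ ∈ lookup σ i
  ⟦ `¬ φ ⟧      ρ σ = ¬ ⟦ φ ⟧ ρ σ
  ⟦ φ `∧ ψ ⟧    ρ σ = ⟦ φ ⟧ ρ σ × ⟦ ψ ⟧ ρ σ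
  ⟦ φ `∨ ψ ⟧    ρ σ = ⟦ φ ⟧ ρ σ ∨ ⟦ ψ ⟧ ρ σ
  ⟦ φ `⇒ ψ ⟧    ρ σ = ⟦ φ ⟧ ρ σ → ⟦ ψ ⟧ ρ σ
  ⟦ `∀< t ∙ φ ⟧ ρ σ = ∀ x → x < ⟦ t ⟧ᵗ ρ → ⟦ φ ⟧ (x ∷ ρ) σ
  ⟦ `∃< t ∙ φ ⟧ ρ σ = ∃ᶜ[ x ] (x < ⟦ t ⟧ᵗ ρ × ⟦ φ ⟧ (x ∷ ρ) σ)

  -- The Σ⁰₁ formula ∃b θ(b,a) and the Π⁰₁ formula ∀b θ(b,a), as predicates of a
  -- with number parameters ρ and set parameters σ.
  Σ⁰₁ Π⁰₁ : ∀ {n k} → Σ⁰₀ (suc (suc n)) k → Vec N n → Vec 𝒮 k → N → Set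
  Σ⁰₁ θ ρ σ a = ∃ᶜ[ b ] ⟦ θ ⟧ (b ∷ a ∷ ρ) σ
  Π⁰₁ θ ρ σ a = ∀ b → ⟦ θ ⟧ (b ∷ a ∷ ρ) σ

record RCA₀ (M : L₂-Structure) : Set where
  open L₂-Structure M
  open Semantics M
  field
    suc≢0   : ∀ m → m + 1# ≢ 0#
    suc-inj : ∀ m n → m + 1# ≡ n + 1# → m ≡ n
    +-zero  : ∀ m → m + 0# ≡ m
    +-suc   : ∀ m n → m + (n + 1#) ≡ (m + n) + 1#
    ·-zero  : ∀ m → m · 0# ≡ 0#
    ·-suc   : ∀ m n → m · (n + 1#) ≡ m · n + m
    ≮0      : ∀ m → ¬ (m < 0#)
    <-suc   : ∀ m n → (m < n + 1#) ⇔ (m < n ∨ m ≡ n)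
    Σ⁰₁-induction :
      ∀ {n k} (θ : Σ⁰₀ (suc (suc n)) k) (ρ : Vec N n) (σ : Vec 𝒮 k) →
      Σ⁰₁ θ ρ σ 0# →
      (∀ a → Σ⁰₁ θ ρ σ a → Σ⁰₁ θ ρ σ (a + 1#)) →
      ∀ a → Σ⁰₁ θ ρ σ a
    Δ⁰₁-comprehension :
      ∀ {n k} (θ η : Σ⁰₀ (suc (suc n)) k) (ρ : Vec N n) (σ : Vec 𝒮 k) →
      (∀ a → Σ⁰₁ θ ρ σ a ⇔ Π⁰₁ η ρ σ a) →
      ∃ᶜ[ X ] (∀ a → (a ∈ X) ⇔ Σ⁰₁ θ ρ σ a)

module Principles (M : L₂-Structure) where
  open L₂-Structure M

  numeral : ℕ → N
  numeral zero    = 0#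
  numeral (suc k) = numeral k + 1#

  _≤_ : N → N → Set
  x ≤ y = x < y ∨ x ≡ y

  ⟨_,_⟩ : N → N → N
  ⟨ i , j ⟩ = (i + j) · (i + j) + i

  -- frac m n d codes the rational number (m − n) / d, for d ≢ 0.
  frac : N → N → N → N
  frac m n d = ⟨ ⟨ m , n ⟩ , d ⟩

  -- ℚ is the set of those codes that are least among all codes of the same
  -- rational; (m − n) / d = (m′ − n′) / d′ is cleared of denominators and
  -- subtraction.
  Isℚ : N → Set
  Isℚ q = ∃ᶜ[ m ] ∃ᶜ[ n ] ∃ᶜ[ d ]
    ( q ≡ frac m n d
    × d ≢ 0#
    × (∀ m′ n′ d′ → d′ ≢ 0# →
         m · d′ + n′ · d ≡ m′ · d + n · d′ → q ≤ frac m′ n′ d′))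

  _<ℚ_ : N → N → Set
  x <ℚ y = ∃ᶜ[ m ] ∃ᶜ[ n ] ∃ᶜ[ d ] ∃ᶜ[ m′ ] ∃ᶜ[ n′ ] ∃ᶜ[ d′ ]
    ( x ≡ frac m n d × d ≢ 0#
    × y ≡ frac m′ n′ d′ × d′ ≢ 0#
    × m · d′ + n′ · d < m′ · d + n · d′)

  -- F, as a set of pairs, is a function from A to B.
  IsFunction : (A B : N → Set) → 𝒮 → Set
  IsFunction A B F =
    (∀ p → p ∈ F → ∃ᶜ[ a ] ∃ᶜ[ b ] (A a × B b × p ≡ ⟨ a , b ⟩))
    × (∀ a → A a → ∃!ᶜ λ b → ⟨ a , b ⟩ ∈ F)

  -- A two-element subset of ℚ is coded by its increasing enumeration.
  [ℚ]² : N → Set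
  [ℚ]² p = ∃ᶜ[ x ] ∃ᶜ[ y ] (Isℚ x × Isℚ y × x <ℚ y × p ≡ ⟨ x , y ⟩)

  IsColouring : ℕ → 𝒮 → Set
  IsColouring k F = IsFunction [ℚ]² (_< numeral k) F

  _⊆ℚ : 𝒮 → Set
  S ⊆ℚ = ∀ x → x ∈ S → Isℚ x

  record IsDenseLinearOrderWithoutEndpoints (S : 𝒮) : Set where
    field
      irrefl   : ∀ x → x ∈ S → ¬ (x <ℚ x)
      trans    : ∀ x y z → x ∈ S → y ∈ S → z ∈ S → x <ℚ y → y <ℚ z → x <ℚ z
      total    : ∀ x y → x ∈ S → y ∈ S → x <ℚ y ∨ x ≡ y ∨ y <ℚ x
      nonempty : ∃ᶜ[ x ] (x ∈ S)
      dense    : ∀ x y → x ∈ S → y ∈ S → x <ℚ y →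
                 ∃ᶜ[ z ] (z ∈ S × x <ℚ z × z <ℚ y)
      noLeast    : ∀ x → x ∈ S → ∃ᶜ[ y ] (y ∈ S × y <ℚ x)
      noGreatest : ∀ x → x ∈ S → ∃ᶜ[ y ] (y ∈ S × x <ℚ y)

  record IsIsomorphismOntoℚ (S G : 𝒮) : Set where
    field
      isFunction : IsFunction (_∈ S) Isℚ G
      injective  : ∀ x x′ y → ⟨ x , y ⟩ ∈ G → ⟨ x′ , y ⟩ ∈ G → x ≡ x′
      surjective : ∀ y → Isℚ y → ∃ᶜ[ x ] (x ∈ S × ⟨ x , y ⟩ ∈ G)
      order      : ∀ x x′ y y′ → ⟨ x , y ⟩ ∈ G → ⟨ x′ , y′ ⟩ ∈ G →
                   (x <ℚ x′) ⇔ (y <ℚ y′)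

  HasOrderTypeℚ : 𝒮 → Set
  HasOrderTypeℚ S = ∃ᶜ[ G ] IsIsomorphismOntoℚ S G

  IsInfinite : 𝒮 → Set
  IsInfinite S = ∀ n → ∃ᶜ[ m ] (n < m × m ∈ S)

  -- |F([S]²)| ≤ 2: the colours attained on [S]² lie in some {a, b}.
  AtMostTwoColours : 𝒮 → 𝒮 → Set
  AtMostTwoColours F S = ∃ᶜ[ a ] ∃ᶜ[ b ]
    (∀ x y → x ∈ S → y ∈ S → x <ℚ y →
     ∀ c → ⟨ ⟨ x , y ⟩ , c ⟩ ∈ F → c ≡ a ∨ c ≡ b)

  IsConstantly : ℕ → 𝒮 → 𝒮 → Set
  IsConstantly c F S =
    ∀ x y → x ∈ S → y ∈ S → x <ℚ y → ⟨ ⟨ x , y ⟩ , numeral c ⟩ ∈ F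

  DT²₄,₂ : Set
  DT²₄,₂ = ∀ F → IsColouring 4 F →
    ∃ᶜ[ S ] (S ⊆ℚ × IsDenseLinearOrderWithoutEndpoints S × AtMostTwoColours F S)

  ER² : Set
  ER² = ∀ F → IsColouring 2 F →
    ∃ᶜ[ S ] (S ⊆ℚ × ( (IsInfinite S × IsConstantly 0 F S)
                    ∨ (HasOrderTypeℚ S × IsConstantly 1 F S)))

open Principles public using (DT²₄,₂; ER²)

-- P implies Q over RCA₀: every model of RCA₀ satisfying P satisfies Q.
_⇒[RCA₀]_ : (P Q : L₂-Structure → Set) → Set₁
P ⇒[RCA₀] Q = ∀ M → RCA₀ M → P M → Q M

{-# OPTIONS --safe #-}
module Submission where

open import Defs
open import Algebra.Bundles using (CommutativeSemiring)
open import Algebra.Structures.Biased using (isCommutativeSemiringˡ)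
import Algebra.Solver.Ring.NaturalCoefficients.Default as Solver
open import Data.Empty using (⊥; ⊥-elim)
open import Data.Fin using (zero; suc)
open import Data.Nat using (suc)
open import Data.Product using (Σ; _×_; _,_; proj₁; proj₂)
open import Data.Sum using (_⊎_; inj₁; inj₂)
open import Data.Vec using (Vec; []; _∷_)
open import Function.Base using (id; _∘_)
open import Function.Bundles using (_⇔_; mk⇔; Equivalence)
open import Relation.Binary.PropositionalEquality
  using (_≡_; _≢_; refl; sym; trans; cong; cong₂; subst; subst₂; isEquivalence; module ≡-Reasoning)
open import Relation.Nullary using (¬_)
open import Relation.Nullary.Negation using (Stable)

open Equivalence using (to; from)

-- Join the given colouring f with Sierpiński's colouring, which records whether <ℚ and the order
-- of the codes agree on a pair, and let S be a dense order on which the resulting 4-colouring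
-- takes at most two values.  Both Sierpiński colours occur on S, so on S the value of f depends
-- only on the Sierpiński colour.  If f is 0 on the agreeing pairs, the left-to-right maxima of S
-- in code order form an infinite 0-homogeneous set; if f is 0 on the disagreeing pairs, so do the
-- left-to-right minima. Otherwise f is constantly 1 on S.  An isomorphism from S to ℚ within RCA₀
-- sends, in code order, each x ∈ S to the rational of least code in the right cut; this greedy map
-- is onto without any "back" steps.  Its finite approximations are coded by Gödel's divisibility
-- coding.

-- The joined colouring takes values in {0, 1} on agreeing pairs and in {2, 3} on disagreeing ones.
-- As S contains pairs of both kinds, each half holds exactly one of the two permitted values. Both
-- kinds occur because S has neither a greatest nor a least element, which makes the left-to-right
-- maxima and the left-to-right minima infinite. A model of RCA₀ may contain nonstandard numbers and
-- offers only Σ⁰₁ induction and Δ⁰₁ comprehension, so the isomorphism cannot be built by recursion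
-- in Agda. Choosing the least code at every stage makes the finite approximations unique. Hence
-- "some approximation of sufficient length contains the pair" and "every such approximation
-- contains it" agree, and the map is Δ⁰₁. The same leastness does the work of the back steps: a
-- rational cannot be passed over in favour of larger codes once a point of S fits it.

infixl 1 _>>=_

-- Double negation is a monad, so a do-block argues under the classical ∃ and ∨. Its result is
-- extracted through stability, or is itself a negation.
_>>=_ : {A B : Set} → ¬ ¬ A → (A → ¬ ¬ B) → ¬ ¬ B
(h >>= f) k = h (λ a → f a k)

return : {A : Set} → A → ¬ ¬ A
return a k = k a

em : (A : Set) → ¬ ¬ (A ⊎ ¬ A)
em A k = k (inj₂ (k ∘ inj₁))

run : ¬ ¬ ⊥ → ⊥
run h = h id

-- De Bruijn variables and pairing terms of the object language

v0 : ∀ {n} → Term (suc n)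
v0 = var zero
v1 : ∀ {n} → Term (suc (suc n))
v1 = var (suc zero)
v2 : ∀ {n} → Term (suc (suc (suc n)))
v2 = var (suc (suc zero))
v3 : ∀ {n} → Term (suc (suc (suc (suc n))))
v3 = var (suc (suc (suc zero)))
v4 : ∀ {n} → Term (suc (suc (suc (suc (suc n)))))
v4 = var (suc (suc (suc (suc zero))))
v5 : ∀ {n} → Term (suc (suc (suc (suc (suc (suc n))))))
v5 = var (suc (suc (suc (suc (suc zero)))))
v6 : ∀ {n} → Term (suc (suc (suc (suc (suc (suc (suc n)))))))
v6 = var (suc (suc (suc (suc (suc (suc zero))))))
v7 : ∀ {n} → Term (suc (suc (suc (suc (suc (suc (suc (suc n))))))))
v7 = var (suc (suc (suc (suc (suc (suc (suc zero)))))))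

`⟨_,_⟩ : ∀ {n} → Term n → Term n → Term n
`⟨ s , t ⟩ = ((s `+ t) `· (s `+ t)) `+ s

-- Basic arithmetic in a model of RCA₀

module Arithmetic (M : L₂-Structure) (rca : RCA₀ M) where
  open L₂-Structure M public
  open Semantics M public
  open Principles M public using (⟨_,_⟩)
  open RCA₀ rca public

  -- Only atoms need the stability fields of the structure, since ∃ and ∨ are already negations.
  -- This lets Σ⁰₀ statements be proved inside the double-negation monad.
  ⟦⟧-stable : ∀ {n k} (φ : Σ⁰₀ n k) (ρ : Vec N n) (σ : Vec 𝒮 k) → Stable (⟦ φ ⟧ ρ σ)
  ⟦⟧-stable (s `= t)    ρ σ h = ≡-stable _ _ h
  ⟦⟧-stable (s `< t)    ρ σ h = <-stable _ _ h
  ⟦⟧-stable (t `∈ i)    ρ σ h = ∈-stable _ _ h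
  ⟦⟧-stable (`¬ φ)      ρ σ h = λ p → h (λ np → np p)
  ⟦⟧-stable (φ `∧ ψ)    ρ σ h =
    ⟦⟧-stable φ ρ σ (λ k → h (k ∘ proj₁)) , ⟦⟧-stable ψ ρ σ (λ k → h (k ∘ proj₂))
  ⟦⟧-stable (φ `∨ ψ)    ρ σ h = h >>= id
  ⟦⟧-stable (φ `⇒ ψ)    ρ σ h = λ p → ⟦⟧-stable ψ ρ σ (λ k → h (λ f → k (f p)))
  ⟦⟧-stable (`∀< t ∙ φ) ρ σ h = λ x l → ⟦⟧-stable φ (x ∷ ρ) σ (λ k → h (λ f → k (f x l)))
  ⟦⟧-stable (`∃< t ∙ φ) ρ σ h = h >>= id

  -- Variable 0 is the unbounded witness of the Σ⁰₁ schema; it is pinned to 0#.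
  induction : ∀ {n k} (φ : Σ⁰₀ (suc (suc n)) k) (ρ : Vec N n) (σ : Vec 𝒮 k) →
    ⟦ φ ⟧ (0# ∷ 0# ∷ ρ) σ →
    (∀ a → ⟦ φ ⟧ (0# ∷ a ∷ ρ) σ → ⟦ φ ⟧ (0# ∷ (a + 1#) ∷ ρ) σ) →
    ∀ a → ⟦ φ ⟧ (0# ∷ a ∷ ρ) σ
  induction φ ρ σ base step a = ⟦⟧-stable φ _ _ λ k →
    Σ⁰₁-induction ((v0 `= `0) `∧ φ) ρ σ
      (return (0# , refl , base))
      (λ b h → h >>= λ { (_ , refl , p) → return (0# , refl , step b p) })
      a λ { (_ , refl , p) → k p }

  +-identityˡ : ∀ n → 0# + n ≡ n
  +-identityˡ = induction ((`0 `+ v1) `= v1) [] [] (+-zero 0#)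
    (λ a h → trans (+-suc 0# a) (cong (_+ 1#) h))

  suc-+ : ∀ m n → (m + 1#) + n ≡ (m + n) + 1#
  suc-+ m = induction (((v2 `+ `1) `+ v1) `= ((v2 `+ v1) `+ `1)) (m ∷ []) []
    (trans (+-zero _) (cong (_+ 1#) (sym (+-zero m))))
    (λ a h → trans (+-suc _ a) (cong (_+ 1#) (trans h (sym (+-suc m a)))))

  +-comm : ∀ m n → m + n ≡ n + m
  +-comm m = induction ((v2 `+ v1) `= (v1 `+ v2)) (m ∷ []) []
    (trans (+-zero m) (sym (+-identityˡ m)))
    (λ a h → trans (+-suc m a) (trans (cong (_+ 1#) h) (sym (suc-+ a m))))

  +-assoc : ∀ l m n → (l + m) + n ≡ l + (m + n)
  +-assoc l m = induction (((v2 `+ v3) `+ v1) `= (v2 `+ (v3 `+ v1))) (l ∷ m ∷ []) []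
    (trans (+-zero _) (cong (l +_) (sym (+-zero m))))
    (λ a h → trans (+-suc _ a) (trans (cong (_+ 1#) h)
       (trans (sym (+-suc l _)) (cong (l +_) (sym (+-suc m a))))))

  ·-zeroˡ : ∀ n → 0# · n ≡ 0#
  ·-zeroˡ = induction ((`0 `· v1) `= `0) [] [] (·-zero 0#)
    (λ a h → trans (·-suc 0# a) (trans (+-zero _) h))

  +-swapʳ : ∀ a b c → (a + b) + c ≡ (a + c) + b
  +-swapʳ a b c = trans (+-assoc a b c) (trans (cong (a +_) (+-comm b c)) (sym (+-assoc a c b)))

  suc-· : ∀ m n → (m + 1#) · n ≡ m · n + n
  suc-· m = induction (((v2 `+ `1) `· v1) `= ((v2 `· v1) `+ v1)) (m ∷ []) []
    (trans (·-zero _) (sym (trans (+-zero _) (·-zero m))))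
    (λ a h → begin
      (m + 1#) · (a + 1#)       ≡⟨ ·-suc (m + 1#) a ⟩
      (m + 1#) · a + (m + 1#)   ≡⟨ cong (_+ (m + 1#)) h ⟩
      (m · a + a) + (m + 1#)    ≡⟨ sym (+-assoc _ m 1#) ⟩
      ((m · a + a) + m) + 1#    ≡⟨ cong (_+ 1#) (+-swapʳ (m · a) a m) ⟩
      ((m · a + m) + a) + 1#    ≡⟨ +-assoc _ a 1# ⟩
      (m · a + m) + (a + 1#)    ≡⟨ cong (_+ (a + 1#)) (sym (·-suc m a)) ⟩
      m · (a + 1#) + (a + 1#)   ∎)
    where open ≡-Reasoning

  ·-comm : ∀ m n → m · n ≡ n · m
  ·-comm m = induction ((v2 `· v1) `= (v1 `· v2)) (m ∷ []) []
    (trans (·-zero m) (sym (·-zeroˡ m)))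
    (λ a h → trans (·-suc m a) (trans (cong (_+ m) h) (sym (suc-· a m))))

  ·-distribʳ-+ : ∀ n l m → (l + m) · n ≡ l · n + m · n
  ·-distribʳ-+ n l m = induction (((v2 `+ v3) `· v1) `= ((v2 `· v1) `+ (v3 `· v1))) (l ∷ m ∷ []) []
    (trans (·-zero _) (sym (trans (cong₂ _+_ (·-zero l) (·-zero m)) (+-zero 0#))))
    (λ a h → begin
      (l + m) · (a + 1#)            ≡⟨ ·-suc _ a ⟩
      (l + m) · a + (l + m)         ≡⟨ cong (_+ (l + m)) h ⟩
      (l · a + m · a) + (l + m)     ≡⟨ sym (+-assoc _ l m) ⟩
      ((l · a + m · a) + l) + m     ≡⟨ cong (_+ m) (+-swapʳ (l · a) (m · a) l) ⟩
      ((l · a + l) + m · a) + m     ≡⟨ +-assoc _ (m · a) m ⟩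
      (l · a + l) + (m · a + m)     ≡⟨ sym (cong₂ _+_ (·-suc l a) (·-suc m a)) ⟩
      l · (a + 1#) + m · (a + 1#)   ∎)
    n
    where open ≡-Reasoning

  ·-assoc : ∀ l m n → (l · m) · n ≡ l · (m · n)
  ·-assoc l m = induction (((v2 `· v3) `· v1) `= (v2 `· (v3 `· v1))) (l ∷ m ∷ []) []
    (trans (·-zero _) (sym (trans (cong (l ·_) (·-zero m)) (·-zero l))))
    (λ a h → begin
      (l · m) · (a + 1#)        ≡⟨ ·-suc _ a ⟩
      (l · m) · a + l · m       ≡⟨ cong (_+ l · m) h ⟩
      l · (m · a) + l · m       ≡⟨ cong₂ _+_ (·-comm l _) (·-comm l m) ⟩
      (m · a) · l + m · l       ≡⟨ sym (·-distribʳ-+ l (m · a) m) ⟩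
      (m · a + m) · l           ≡⟨ ·-comm _ l ⟩
      l · (m · a + m)           ≡⟨ cong (l ·_) (sym (·-suc m a)) ⟩
      l · (m · (a + 1#))        ∎)
    where open ≡-Reasoning

  ·-identityˡ : ∀ n → 1# · n ≡ n
  ·-identityˡ n = begin
    1# · n         ≡⟨ cong (_· n) (sym (+-identityˡ 1#)) ⟩
    (0# + 1#) · n  ≡⟨ suc-· 0# n ⟩
    0# · n + n     ≡⟨ cong (_+ n) (·-zeroˡ n) ⟩
    0# + n         ≡⟨ +-identityˡ n ⟩
    n              ∎
    where open ≡-Reasoning

  N-commutativeSemiring : CommutativeSemiring _ _
  N-commutativeSemiring = record
    { Carrier = N ; _≈_ = _≡_ ; _+_ = _+_ ; _*_ = _·_ ; 0# = 0# ; 1# = 1#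
    ; isCommutativeSemiring = isCommutativeSemiringˡ record
      { +-isCommutativeMonoid = record
        { isMonoid = record
          { isSemigroup = record
            { isMagma = record { isEquivalence = isEquivalence ; ∙-cong = cong₂ _+_ }
            ; assoc = +-assoc }
          ; identity = +-identityˡ , +-zero }
        ; comm = +-comm }
      ; *-isCommutativeMonoid = record
        { isMonoid = record
          { isSemigroup = record
            { isMagma = record { isEquivalence = isEquivalence ; ∙-cong = cong₂ _·_ }
            ; assoc = ·-assoc }
          ; identity = ·-identityˡ , λ n → trans (·-comm n 1#) (·-identityˡ n) }
        ; comm = ·-comm }
      ; distribʳ = ·-distribʳ-+
      ; zeroˡ = ·-zeroˡ } }

  open Solver N-commutativeSemiring public using (solve; _:=_; _:+_; _:*_; con)

  -- Cancellation and the order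

  +-cancelʳ : ∀ x y n → x + n ≡ y + n → x ≡ y
  +-cancelʳ x y = induction (((v2 `+ v1) `= (v3 `+ v1)) `⇒ (v2 `= v3)) (x ∷ y ∷ []) []
    (λ h → trans (sym (+-zero x)) (trans h (+-zero y)))
    (λ a ih h → ih (suc-inj _ _ (trans (sym (+-suc x a)) (trans h (+-suc y a)))))

  x≢x+suc : ∀ x z → x ≢ x + (z + 1#)
  x≢x+suc x z h = suc≢0 z (sym (+-cancelʳ 0# (z + 1#) x
    (trans (+-identityˡ x) (trans h (+-comm x _)))))

  x<x+suc : ∀ x z → x < x + (z + 1#)
  x<x+suc x = induction (v2 `< (v2 `+ (v1 `+ `1))) (x ∷ []) []
    (subst (x <_) (cong (x +_) (sym (+-identityˡ 1#))) (from (<-suc x x) (return (inj₂ refl))))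
    (λ a h → subst (x <_) (sym (+-suc x _)) (from (<-suc x _) (return (inj₁ h))))

  <⇒∃ : ∀ {x y} → x < y → ∃ᶜ[ z ] (y ≡ x + (z + 1#))
  -- The implication is moved inside the existential to obtain a Σ⁰₁ formula. The witness 0# is a
  -- default while the premise fails, and the true difference at the first step where it holds.
  <⇒∃ {x} {y} x<y = Σ⁰₁-induction ((v2 `< v1) `⇒ (v1 `= (v2 `+ (v0 `+ `1)))) (x ∷ []) []
    (return (0# , λ x<0 → ⊥-elim (≮0 x x<0)))
    (λ a h → h >>= λ { (z , p) → em (x < a) >>= λ
      { (inj₁ x<a) → return (z + 1# , λ _ → trans (cong (_+ 1#) (p x<a)) (sym (+-suc x _)))
      ; (inj₂ x≮a) → return (0# , λ x<sa → ≡-stable _ _ (to (<-suc x a) x<sa >>= λ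
          { (inj₁ x<a) → ⊥-elim (x≮a x<a)
          ; (inj₂ refl) → return (cong (x +_) (sym (+-identityˡ 1#))) })) } })
    y >>= λ { (z , p) → return (z , p x<y) }

  ∃⇒< : ∀ {x y} z → y ≡ x + (z + 1#) → x < y
  ∃⇒< {x} z refl = x<x+suc x z

  <-irrefl : ∀ {x} → ¬ (x < x)
  <-irrefl {x} h = <⇒∃ h λ { (z , p) → x≢x+suc x z p }

  <-trans : ∀ {x y z} → x < y → y < z → x < z
  <-trans {x} {y} {z} p q = <-stable _ _ do
    a , refl ← <⇒∃ p
    b , refl ← <⇒∃ q
    return (∃⇒< (a + (b + 1#)) (solve 3 (λ x a b →
      (x :+ (a :+ con 1)) :+ (b :+ con 1) := x :+ ((a :+ (b :+ con 1)) :+ con 1)) refl x a b))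

  n<n+1 : ∀ n → n < n + 1#
  n<n+1 n = from (<-suc n n) (return (inj₂ refl))

  <⇒<suc : ∀ {m n} → m < n → m < n + 1#
  <⇒<suc m<n = from (<-suc _ _) (return (inj₁ m<n))

  -- `x < y + 1#` stands for x ≤ y throughout, because the bounded quantifiers of the object
  -- language are strict.
  <suc⇒ : ∀ {m n} → m < n + 1# → ¬ ¬ (m < n ⊎ m ≡ n)
  <suc⇒ = to (<-suc _ _)

  m<m+n+1 : ∀ m n → m < (m + n) + 1#
  m<m+n+1 m n = ∃⇒< n (+-assoc m n 1#)

  n<m+n+1 : ∀ m n → n < (m + n) + 1#
  n<m+n+1 m n = subst (λ t → n < t + 1#) (+-comm n m) (m<m+n+1 n m)

  <suc⇒∃ : ∀ {x y} → x < y + 1# → ∃ᶜ[ z ] (y ≡ x + z)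
  <suc⇒∃ {x} h = do
    z , p ← <⇒∃ h
    return (z , suc-inj _ _ (trans p (sym (+-assoc x z 1#))))

  <-<suc-trans : ∀ {x y z} → x < y → y < z + 1# → x < z
  <-<suc-trans p q = <-stable _ _ (<suc⇒ q >>= λ
    { (inj₁ q′) → return (<-trans p q′) ; (inj₂ refl) → return p })

  <suc-<-trans : ∀ {x y z} → x < y + 1# → y < z → x < z
  <suc-<-trans p q = <-stable _ _ (<suc⇒ p >>= λ
    { (inj₁ p′) → return (<-trans p′ q) ; (inj₂ refl) → return q })

  <suc-trans : ∀ {x y z} → x < y + 1# → y < z + 1# → x < z + 1#
  <suc-trans p q = <suc-<-trans p q

  suc-mono-< : ∀ {x y} → x < y → x + 1# < y + 1#
  suc-mono-< {x} p = <-stable _ _ do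
    z , refl ← <⇒∃ p
    return (∃⇒< z (solve 2 (λ x z → (x :+ (z :+ con 1)) :+ con 1 := (x :+ con 1) :+ (z :+ con 1)) refl x z))

  data Tri (x y : N) : Set where
    lt : x < y → Tri x y
    eq : x ≡ y → Tri x y
    gt : y < x → Tri x y

  0<suc : ∀ n → 0# < n + 1#
  0<suc n = ∃⇒< n (sym (+-identityˡ _))

  <-tri : ∀ x y → ¬ ¬ Tri x y
  <-tri x y = induction ((v2 `< v1) `∨ ((v2 `= v1) `∨ (v1 `< v2))) (x ∷ []) []
    (induction ((v1 `< `0) `∨ ((v1 `= `0) `∨ (`0 `< v1))) [] []
      (return (inj₂ (return (inj₁ refl))))
      (λ a _ → return (inj₂ (return (inj₂ (0<suc a))))) x)
    (λ a h → h >>= λ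
      { (inj₁ l) → return (inj₁ (<⇒<suc l))
      ; (inj₂ h) → h >>= λ
        { (inj₁ refl) → return (inj₁ (n<n+1 a))
        ; (inj₂ g) → do
            z , refl ← <⇒∃ g
            inj₂ (w , refl) ← zeroOrSuc z where
              inj₁ refl → return (inj₂ (return (inj₁ (cong (a +_) (+-identityˡ 1#)))))
            return (inj₂ (return (inj₂ (∃⇒< w (solve 2 (λ a w →
              a :+ ((w :+ con 1) :+ con 1) := (a :+ con 1) :+ (w :+ con 1)) refl a w))))) } })
    y >>= λ { (inj₁ l) → return (lt l) ; (inj₂ h) → h >>= λ
      { (inj₁ e) → return (eq e) ; (inj₂ g) → return (gt g) } }
    where
    zeroOrSuc : ∀ z → ¬ ¬ (z ≡ 0# ⊎ Σ N λ w → z ≡ w + 1#)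
    zeroOrSuc z = Σ⁰₁-induction ((v1 `= `0) `∨ (v1 `= (v0 `+ `1))) [] []
      (return (0# , return (inj₁ refl)))
      (λ a _ → return (a , return (inj₂ refl))) z
      >>= λ { (w , h) → h >>= λ { (inj₁ p) → return (inj₁ p) ; (inj₂ p) → return (inj₂ (w , p)) } }

  ≢0⇒suc : ∀ {z} → z ≢ 0# → ∃ᶜ[ w ] (z ≡ w + 1#)
  ≢0⇒suc {z} z≢0 = <-tri z 0# >>= λ
    { (lt l) → ⊥-elim (≮0 _ l)
    ; (eq p) → ⊥-elim (z≢0 p)
    ; (gt g) → <⇒∃ g >>= λ { (w , p) → return (w , trans p (+-identityˡ _)) } }

  ≮⇒<suc : ∀ {x y} → ¬ (x < y) → y < x + 1#
  ≮⇒<suc {x} {y} x≮y = <-stable _ _ (<-tri x y >>= λ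
    { (lt l) → ⊥-elim (x≮y l)
    ; (eq refl) → return (n<n+1 x)
    ; (gt g) → return (<⇒<suc g) })

  <suc⇒≯ : ∀ {x y} → x < y + 1# → ¬ (y < x)
  <suc⇒≯ p q = <-irrefl (<-<suc-trans q p)

  ·-cancelʳ-< : ∀ {x y} c → x · c < y · c → x < y
  ·-cancelʳ-< {x} {y} c h = <-stable _ _ (<-tri x y >>= λ
    { (lt l) → return l
    ; (eq refl) → ⊥-elim (<-irrefl h)
    ; (gt g) → <⇒∃ g >>= λ { (z , refl) → ⊥-elim (<suc⇒≯ {y · c}
        (subst (λ t → y · c < t + 1#) (sym (·-distribʳ-+ c y (z + 1#))) (m<m+n+1 _ _)) h) } })

  1≢0 : 1# ≢ 0#
  1≢0 h = suc≢0 0# (trans (+-identityˡ 1#) h)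

  +≢0 : ∀ {x} y → x ≢ 0# → x + y ≢ 0#
  +≢0 {x} y x≢0 h = ≢0⇒suc x≢0 λ { (w , refl) → suc≢0 (w + y) (trans (sym (suc-+ w y)) h) }

  ·≢0 : ∀ {x y} → x ≢ 0# → y ≢ 0# → x · y ≢ 0#
  ·≢0 {x} {y} x≢0 y≢0 h = ≢0⇒suc x≢0 λ { (w , refl) →
    +≢0 (w · y) y≢0 (trans (+-comm y _) (trans (sym (suc-· w y)) h)) }

  +-< : ∀ {x y} e → e ≢ 0# → x + e ≡ y → x < y
  +-< e e≢0 h = <-stable _ _ (≢0⇒suc e≢0 >>= λ { (w , refl) → return (∃⇒< w (sym h)) })

  ·-cancelʳ-≡ : ∀ {x y} c → c ≢ 0# → x · c ≡ y · c → x ≡ y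
  ·-cancelʳ-≡ {x} {y} c c≢0 h = ≡-stable _ _ (<-tri x y >>= λ
    { (lt l) → ⊥-elim (strict l h)
    ; (eq p) → return p
    ; (gt g) → ⊥-elim (strict g (sym h)) })
    where
    strict : ∀ {x y} → x < y → x · c ≢ y · c
    strict {x} l h = <⇒∃ l λ { (z , refl) → <-irrefl (subst (x · c <_) (sym h)
      (+-< ((z + 1#) · c) (·≢0 (suc≢0 z) c≢0) (sym (·-distribʳ-+ c x (z + 1#))))) }

  -- The pairing function

  n<n·n+1 : ∀ n → n < n · n + 1#
  n<n·n+1 n = <-stable _ _ (em (n ≡ 0#) >>= λ
    { (inj₁ refl) → return (0<suc _)
    ; (inj₂ n≢0) → ≢0⇒suc n≢0 >>= λ { (w , refl) → return (∃⇒< (w · w + w) (solve 1 (λ w →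
        (w :+ con 1) :* (w :+ con 1) :+ con 1 := (w :+ con 1) :+ ((w :* w :+ w) :+ con 1)) refl w)) } })

  x+y<⟨x,y⟩+1 : ∀ x y → x + y < ⟨ x , y ⟩ + 1#
  x+y<⟨x,y⟩+1 x y = <suc-trans (n<n·n+1 (x + y)) (m<m+n+1 _ x)

  x<⟨x,y⟩+1 : ∀ x y → x < ⟨ x , y ⟩ + 1#
  x<⟨x,y⟩+1 x y = <suc-trans (m<m+n+1 x y) (x+y<⟨x,y⟩+1 x y)

  y<⟨x,y⟩+1 : ∀ x y → y < ⟨ x , y ⟩ + 1#
  y<⟨x,y⟩+1 x y = <suc-trans (n<m+n+1 x y) (x+y<⟨x,y⟩+1 x y)

  -- A code is the square of the sum plus x, and x is at most the sum, so it stays below the next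
  -- square.
  ⟨,⟩-mono-< : ∀ x y x′ y′ → x + y < x′ + y′ → ⟨ x , y ⟩ < ⟨ x′ , y′ ⟩
  ⟨,⟩-mono-< x y x′ y′ h = <-stable _ _ do
    z , p ← <⇒∃ h
    let s = x + y
        t = z + 1#
    -- The witness is 2st + t² + x′ - x - 1 written without subtraction: one copy of s in 2st pays
    -- for -x and leaves y.
    return (∃⇒< (s · z + t · (s + z) + y + z + x′)
      (trans (cong (λ u → u · u + x′) p) (solve 4 (λ x y z x′ →
        let s = x :+ y ; t = z :+ con 1 in
        (s :+ t) :* (s :+ t) :+ x′ :=
        (s :* s :+ x) :+ ((s :* z :+ t :* (s :+ z) :+ y :+ z :+ x′) :+ con 1)) refl x y z x′)))

  ⟨,⟩-injective : ∀ {x y x′ y′} → ⟨ x , y ⟩ ≡ ⟨ x′ , y′ ⟩ → x ≡ x′ × y ≡ y′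
  ⟨,⟩-injective {x} {y} {x′} {y′} h = x≡x′ , +-cancelʳ y y′ x′
    (trans (+-comm y x′) (trans (cong (_+ y) (sym x≡x′)) (trans sums (+-comm x′ y′))))
    where
    sums : x + y ≡ x′ + y′
    sums = ≡-stable _ _ (<-tri (x + y) (x′ + y′) >>= λ
      { (lt l) → ⊥-elim (<-irrefl (subst (_< ⟨ x′ , y′ ⟩) h (⟨,⟩-mono-< x y x′ y′ l)))
      ; (eq p) → return p
      ; (gt g) → ⊥-elim (<-irrefl (subst (⟨ x′ , y′ ⟩ <_) h (⟨,⟩-mono-< x′ y′ x y g))) })
    x≡x′ : x ≡ x′
    x≡x′ = +-cancelʳ x x′ _ (trans (+-comm x _) (trans
      (trans h (cong (λ u → u · u + x′) (sym sums))) (+-comm _ x′)))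

-- Σ⁰₀ comprehension and its consequences

module Comprehension (M : L₂-Structure) (rca : RCA₀ M) where
  open Arithmetic M rca

  -- As in induction, variable 0 is pinned to 0#, so φ speaks about variable 1.
  comprehension : ∀ {n k} (φ : Σ⁰₀ (suc (suc n)) k) (ρ : Vec N n) (σ : Vec 𝒮 k) →
    ∃ᶜ[ X ] (∀ a → (a ∈ X) ⇔ ⟦ φ ⟧ (0# ∷ a ∷ ρ) σ)
  comprehension φ ρ σ = do
    X , h ← Δ⁰₁-comprehension ((v0 `= `0) `∧ φ) ((v0 `= `0) `⇒ φ) ρ σ λ a → mk⇔
      (λ h b b≡0 → ⟦⟧-stable φ _ _ λ k → h λ { (_ , refl , p) → k (subst (λ t → ⟦ φ ⟧ (t ∷ a ∷ ρ) σ) (sym b≡0) p) })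
      (λ h → return (0# , refl , h 0# refl))
    return (X , λ a → mk⇔
      (λ a∈X → ⟦⟧-stable φ _ _ λ k → to (h a) a∈X λ { (_ , refl , p) → k p })
      (λ p → from (h a) (return (0# , refl , p))))

  -- The components of a pair are bounded by its code, so decoding is Σ⁰₀. In φ, variables 0 and 1
  -- are y and x, variable 2 is the pinned dummy, 3 is the code, and parameters start at 4.
  comprehension₂ : ∀ {n k} (φ : Σ⁰₀ (suc (suc (suc (suc n)))) k) (ρ : Vec N n) (σ : Vec 𝒮 k) →
    ∃ᶜ[ X ] (∀ x y → (⟨ x , y ⟩ ∈ X) ⇔ ⟦ φ ⟧ (y ∷ x ∷ 0# ∷ ⟨ x , y ⟩ ∷ ρ) σ)
  comprehension₂ φ ρ σ = do
    X , h ← comprehension (`∃< (v1 `+ `1) ∙ (`∃< (v2 `+ `1) ∙ ((v3 `= `⟨ v1 , v0 ⟩) `∧ φ))) ρ σ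
    return (X , λ x y → mk⇔
      (λ p∈X → ⟦⟧-stable φ _ _ do
        x′ , _ , r ← to (h _) p∈X
        y′ , _ , e , p ← r
        return (subst₂ (λ s t → ⟦ φ ⟧ (t ∷ s ∷ 0# ∷ ⟨ x , y ⟩ ∷ ρ) σ)
          (sym (proj₁ (⟨,⟩-injective e))) (sym (proj₂ (⟨,⟩-injective e))) p))
      (λ p → from (h _) (return (x , x<⟨x,y⟩+1 x y , return (y , y<⟨x,y⟩+1 x y , refl , p)))))

  -- The first clause excludes stray numbers, as is required of a set that is to be a colouring.
  comprehension₃ : ∀ {n k} (φ : Σ⁰₀ (suc (suc (suc (suc (suc n))))) k) (ρ : Vec N n) (σ : Vec 𝒮 k) →
    ∃ᶜ[ X ] ((∀ p → p ∈ X → ∃ᶜ[ x ] ∃ᶜ[ y ] ∃ᶜ[ z ] (p ≡ ⟨ ⟨ x , y ⟩ , z ⟩))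
           × (∀ x y z → (⟨ ⟨ x , y ⟩ , z ⟩ ∈ X) ⇔ ⟦ φ ⟧ (z ∷ y ∷ x ∷ 0# ∷ ⟨ ⟨ x , y ⟩ , z ⟩ ∷ ρ) σ))
  comprehension₃ φ ρ σ = do
    X , h ← comprehension (`∃< (v1 `+ `1) ∙ (`∃< (v2 `+ `1) ∙ (`∃< (v3 `+ `1) ∙
              ((v4 `= `⟨ `⟨ v2 , v1 ⟩ , v0 ⟩) `∧ φ)))) ρ σ
    return (X
      , (λ p p∈X → do
          x , _ , r ← to (h p) p∈X
          y , _ , r ← r
          z , _ , e , _ ← r
          return (x , return (y , return (z , e))))
      , λ x y z → mk⇔
      (λ p∈X → ⟦⟧-stable φ _ _ do
        x′ , _ , r ← to (h _) p∈X
        y′ , _ , r ← r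
        z′ , _ , e , p ← r
        let e₁ , z≡ = ⟨,⟩-injective e
            x≡ , y≡ = ⟨,⟩-injective e₁
        return (subst (λ t → ⟦ φ ⟧ (t ∷ y ∷ x ∷ 0# ∷ ⟨ ⟨ x , y ⟩ , z ⟩ ∷ ρ) σ) (sym z≡)
          (subst₂ (λ s t → ⟦ φ ⟧ (z′ ∷ t ∷ s ∷ 0# ∷ ⟨ ⟨ x , y ⟩ , z ⟩ ∷ ρ) σ) (sym x≡) (sym y≡) p)))
      (λ p → from (h _) (return
        ( x , <suc-trans (x<⟨x,y⟩+1 x y) (x<⟨x,y⟩+1 _ z) , return
        ( y , <suc-trans (y<⟨x,y⟩+1 x y) (x<⟨x,y⟩+1 _ z) , return
        ( z , y<⟨x,y⟩+1 _ z , refl , p))))))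

  -- If X had no least element, induction on b would show that nothing below b is in X, which is a
  -- Σ⁰₀ statement.
  least : ∀ X a → a ∈ X → ∃ᶜ[ m ] (m ∈ X × (∀ y → y < m → ¬ (y ∈ X)))
  least X a a∈X none = induction (`∀< v1 ∙ (`¬ (v0 `∈ zero))) [] (X ∷ [])
    (λ y y<0 → ⊥-elim (≮0 y y<0))
    (λ b ih y y<sb y∈X → <suc⇒ y<sb λ
      { (inj₁ y<b) → ih y y<b y∈X
      ; (inj₂ refl) → none (y , y∈X , ih) })
    (a + 1#) a (n<n+1 a) a∈X

  -- The failures of φ form a set, and its least element would contradict `step`.
  strongInduction : ∀ {n k} (φ : Σ⁰₀ (suc (suc n)) k) (ρ : Vec N n) (σ : Vec 𝒮 k) →
    (∀ a → (∀ b → b < a → ⟦ φ ⟧ (0# ∷ b ∷ ρ) σ) → ⟦ φ ⟧ (0# ∷ a ∷ ρ) σ) →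
    ∀ a → ⟦ φ ⟧ (0# ∷ a ∷ ρ) σ
  strongInduction φ ρ σ step a = ⟦⟧-stable φ _ _ λ ¬φa →
    comprehension (`¬ φ) ρ σ λ { (X , h) → least X a (from (h a) ¬φa) λ
      { (m , m∈X , below) → to (h m) m∈X (step m λ b b<m →
          ⟦⟧-stable φ _ _ λ ¬φb → below b b<m (from (h b) ¬φb)) } }

-- The rationals as a dense linear order

module Rationals (M : L₂-Structure) (rca : RCA₀ M) where
  open Arithmetic M rca
  open Comprehension M rca
  open Principles M using (frac; Isℚ; _<ℚ_)

  -- (pos − neg) / den
  record Frac : Set where
    field
      pos neg den : N
      den≢0 : den ≢ 0#
  open Frac

  code : Frac → N
  code a = frac (pos a) (neg a) (den a)

  -- Cross-multiplied comparison: b − a equals e / (den a · den b).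
  Diff : Frac → Frac → N → Set
  Diff a b e = (pos a · den b + neg b · den a) + e ≡ pos b · den a + neg a · den b

  infix 4 _≺_ _≈_
  _≺_ _≈_ : Frac → Frac → Set
  a ≺ b = pos a · den b + neg b · den a < pos b · den a + neg a · den b
  a ≈ b = pos a · den b + neg b · den a ≡ pos b · den a + neg a · den b

  ≺⇒Diff : ∀ {a b} → a ≺ b → ∃ᶜ[ z ] Diff a b (z + 1#)
  ≺⇒Diff a≺b = <⇒∃ a≺b >>= λ { (z , h) → return (z , sym h) }

  ≈⇒Diff : ∀ {a b} → a ≈ b → Diff a b 0#
  ≈⇒Diff a≈b = trans (+-zero _) a≈b

  -- This is c - a = (b - a) + (c - b), multiplied by all three denominators; `k` collects the terms
  -- of b that cancel. Taking `e` and `e′` to be 0# or successors gives all four transitivity laws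
  -- for ≺ and ≈.
  Diff-trans : ∀ {a b c e e′} → Diff a b e → Diff b c e′ →
    (pos a · den c + neg c · den a) · den b + (e · den c + e′ · den a)
      ≡ (pos c · den a + neg a · den c) · den b
  Diff-trans {a} {b} {c} {e} {e′} p q = +-cancelʳ _ _ k (begin
      lhs + k
        ≡⟨ solve 11 (λ a₁ a₂ a₃ b₁ b₂ b₃ c₁ c₂ c₃ e e′ →
             ((a₁ :* c₃ :+ c₂ :* a₃) :* b₃ :+ (e :* c₃ :+ e′ :* a₃)) :+ (b₁ :+ b₂) :* (a₃ :* c₃)
             := ((a₁ :* b₃ :+ b₂ :* a₃) :+ e) :* c₃ :+ ((b₁ :* c₃ :+ c₂ :* b₃) :+ e′) :* a₃)
             refl (pos a) (neg a) (den a) (pos b) (neg b) (den b) (pos c) (neg c) (den c) e e′ ⟩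
      ((pos a · den b + neg b · den a) + e) · den c + ((pos b · den c + neg c · den b) + e′) · den a
        ≡⟨ cong₂ (λ s t → s · den c + t · den a) p q ⟩
      (pos b · den a + neg a · den b) · den c + (pos c · den b + neg b · den c) · den a
        ≡⟨ solve 9 (λ a₁ a₂ a₃ b₁ b₂ b₃ c₁ c₂ c₃ →
             (b₁ :* a₃ :+ a₂ :* b₃) :* c₃ :+ (c₁ :* b₃ :+ b₂ :* c₃) :* a₃
             := (c₁ :* a₃ :+ a₂ :* c₃) :* b₃ :+ (b₁ :+ b₂) :* (a₃ :* c₃))
             refl (pos a) (neg a) (den a) (pos b) (neg b) (den b) (pos c) (neg c) (den c) ⟩
      (pos c · den a + neg a · den c) · den b + k ∎)
    where
    open ≡-Reasoning
    lhs = (pos a · den c + neg c · den a) · den b + (e · den c + e′ · den a)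
    k = (pos b + neg b) · (den a · den c)

  ≈-trans : ∀ {a b c} → a ≈ b → b ≈ c → a ≈ c
  ≈-trans {a} {b} {c} p q = ·-cancelʳ-≡ (den b) (den≢0 b) (trans
    (sym (trans (cong (lhs +_) (cong₂ _+_ (·-zeroˡ (den c)) (·-zeroˡ (den a))))
      (trans (cong (lhs +_) (+-zero 0#)) (+-zero lhs))))
    (Diff-trans {a} {b} {c} (≈⇒Diff {a} {b} p) (≈⇒Diff {b} {c} q)))
    where lhs = (pos a · den c + neg c · den a) · den b

  ≺-≈-trans : ∀ {a b c} → a ≺ b → b ≈ c → a ≺ c
  ≺-≈-trans {a} {b} {c} p q = <-stable _ _ do
    z , d ← ≺⇒Diff {a} {b} p
    return (·-cancelʳ-< (den b) (+-< _ (+≢0 _ (·≢0 (suc≢0 z) (den≢0 c)))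
      (Diff-trans {a} {b} {c} d (≈⇒Diff {b} {c} q))))

  ≺-trans : ∀ {a b c} → a ≺ b → b ≺ c → a ≺ c
  ≺-trans {a} {b} {c} p q = <-stable _ _ do
    z , d ← ≺⇒Diff {a} {b} p
    _ , d′ ← ≺⇒Diff {b} {c} q
    return (·-cancelʳ-< (den b) (+-< _ (+≢0 _ (·≢0 (suc≢0 z) (den≢0 c)))
      (Diff-trans {a} {b} {c} d d′)))

  ≈-≺-trans : ∀ {a b c} → a ≈ b → b ≺ c → a ≺ c
  ≈-≺-trans {a} {b} {c} p q = <-stable _ _ do
    z , d ← ≺⇒Diff {b} {c} q
    return (·-cancelʳ-< (den b) (+-< _
      (λ h → +≢0 _ (·≢0 (suc≢0 z) (den≢0 a)) (trans (+-comm _ _) h))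
      (Diff-trans {a} {b} {c} (≈⇒Diff {a} {b} p) d)))

  ≺-irrefl : ∀ {a} → ¬ (a ≺ a)
  ≺-irrefl = <-irrefl

  ≺-respects-code : ∀ a b a′ b′ → code a ≡ code a′ → code b ≡ code b′ → a ≺ b → a′ ≺ b′
  ≺-respects-code a b a′ b′ p q a≺b with ⟨,⟩-injective p | ⟨,⟩-injective q
  ... | p₁ , p₂ | q₁ , q₂ with ⟨,⟩-injective p₁ | ⟨,⟩-injective q₁
  ... | r₁ , r₂ | s₁ , s₂ = subst₂ _<_
    (cong₂ _+_ (cong₂ _·_ r₁ q₂) (cong₂ _·_ s₂ p₂))
    (cong₂ _+_ (cong₂ _·_ s₁ p₂) (cong₂ _·_ r₂ q₂)) a≺b

  pos<code+1 : ∀ m n d → m < frac m n d + 1#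
  pos<code+1 m n d = <suc-trans (x<⟨x,y⟩+1 m n) (x<⟨x,y⟩+1 _ d)

  neg<code+1 : ∀ m n d → n < frac m n d + 1#
  neg<code+1 m n d = <suc-trans (y<⟨x,y⟩+1 m n) (x<⟨x,y⟩+1 _ d)

  den<code+1 : ∀ m n d → d < frac m n d + 1#
  den<code+1 m n d = y<⟨x,y⟩+1 _ d

  ≺⇒<ℚ : ∀ a b → a ≺ b → code a <ℚ code b
  ≺⇒<ℚ a b a≺b = return (pos a , return (neg a , return (den a , return (pos b , return (neg b ,
    return (den b , refl , den≢0 a , refl , den≢0 b , a≺b))))))

  <ℚ⇒≺ : ∀ {x y} → x <ℚ y → ¬ ¬ Σ (Frac × Frac) λ { (a , b) → x ≡ code a × y ≡ code b × a ≺ b }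
  <ℚ⇒≺ h = do
    m , h ← h
    n , h ← h
    d , h ← h
    m′ , h ← h
    n′ , h ← h
    d′ , x≡ , d≢0 , y≡ , d′≢0 , l ← h
    return ((record { pos = m ; neg = n ; den = d ; den≢0 = d≢0 }
           , record { pos = m′ ; neg = n′ ; den = d′ ; den≢0 = d′≢0 }) , x≡ , y≡ , l)

  <ℚ-irrefl : ∀ x → ¬ (x <ℚ x)
  <ℚ-irrefl x h = <ℚ⇒≺ h λ { ((a , b) , p , q , l) →
    ≺-irrefl {a} (≺-respects-code a b a a refl (trans (sym q) p) l) }

  <ℚ-trans : ∀ {x y z} → x <ℚ y → y <ℚ z → x <ℚ z
  <ℚ-trans h h′ = do
    (a , b) , p , q , l ← <ℚ⇒≺ h
    (b′ , c) , p′ , q′ , l′ ← <ℚ⇒≺ h′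
    subst₂ _<ℚ_ (sym p) (sym q′) (≺⇒<ℚ a c
      (≺-trans {a} {b} {c} l (≺-respects-code b′ c b c (trans (sym p′) q) refl l′)))

  Least : Frac → Set
  Least a = ∀ b → a ≈ b → code a < code b + 1#

  Isℚ⇒ : ∀ {q} → Isℚ q → ¬ ¬ Σ Frac λ a → q ≡ code a × Least a
  Isℚ⇒ h = do
    m , h ← h
    n , h ← h
    d , q≡ , d≢0 , l ← h
    return (record { pos = m ; neg = n ; den = d ; den≢0 = d≢0 } , q≡ , λ b a≈b →
      subst (_< code b + 1#) q≡ (from (<-suc _ _) (l (pos b) (neg b) (den b) (den≢0 b) a≈b)))

  ⇒Isℚ : ∀ a → Least a → Isℚ (code a)
  ⇒Isℚ a l = return (pos a , return (neg a , return (den a , refl , den≢0 a , λ m n d d≢0 h →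
    to (<-suc _ _) (l (record { pos = m ; neg = n ; den = d ; den≢0 = d≢0 }) h))))

  ℚ-total : ∀ {x y} → Isℚ x → Isℚ y → ¬ ¬ (x <ℚ y ⊎ x ≡ y ⊎ y <ℚ x)
  ℚ-total h h′ = do
    a , refl , l ← Isℚ⇒ h
    b , refl , l′ ← Isℚ⇒ h′
    t ← <-tri (pos a · den b + neg b · den a) (pos b · den a + neg a · den b)
    cases a b l l′ t
    where
    cases : ∀ a b → Least a → Least b →
      Tri (pos a · den b + neg b · den a) (pos b · den a + neg a · den b) →
      ¬ ¬ (code a <ℚ code b ⊎ code a ≡ code b ⊎ code b <ℚ code a)
    cases a b l l′ (lt p) = return (inj₁ (≺⇒<ℚ a b p))
    -- Two least codes of the same rational bound each other, hence coincide.
    cases a b l l′ (eq p) = <suc⇒ (l b p) >>= λ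
      { (inj₁ q) → ⊥-elim (<suc⇒≯ (l′ a (sym p)) q)
      ; (inj₂ q) → return (inj₂ (inj₁ q)) }
    cases a b l l′ (gt p) = return (inj₂ (inj₂ (≺⇒<ℚ b a p)))

  -- Components are bounded by codes, so the codes of fractions equivalent to a form a set. Its
  -- least element is least in its own class by `≈-trans`.
  representative : ∀ a → ¬ ¬ Σ Frac λ b → a ≈ b × Least b
  representative a = do
    X , h ← comprehension
      (`∃< (v1 `+ `1) ∙ (`∃< (v2 `+ `1) ∙ (`∃< (v3 `+ `1) ∙
        ((v4 `= `⟨ `⟨ v2 , v1 ⟩ , v0 ⟩) `∧ ((`¬ (v0 `= `0)) `∧
         (((v5 `· v0) `+ (v1 `· v7)) `= ((v2 `· v7) `+ (v6 `· v0))))))))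
      (pos a ∷ neg a ∷ den a ∷ []) []
    let intro : ∀ b → a ≈ b → code b ∈ X
        intro b a≈b = from (h _) (return (pos b , pos<code+1 (pos b) (neg b) (den b) ,
          return (neg b , neg<code+1 (pos b) (neg b) (den b) ,
          return (den b , den<code+1 (pos b) (neg b) (den b) , refl , den≢0 b , a≈b))))
    q , q∈X , below ← least X (code a) (intro a refl)
    m , _ , r ← to (h q) q∈X
    n , _ , r ← r
    d , _ , e , d≢0 , a≈ ← r
    let b = record { pos = m ; neg = n ; den = d ; den≢0 = d≢0 }
    return (b , a≈ , λ c b≈c → ≮⇒<suc λ c<b →
      below (code c) (subst (code c <_) (sym e) c<b) (intro c (≈-trans {a} {b} {c} a≈ b≈c)))

  ℚ-nonempty : ∃ᶜ[ q ] Isℚ q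
  ℚ-nonempty = do
    b , _ , l ← representative record { pos = 0# ; neg = 0# ; den = 0# + 1# ; den≢0 = suc≢0 0# }
    return (code b , ⇒Isℚ b l)

  ℚ-dense : ∀ {x y} → x <ℚ y → ∃ᶜ[ z ] (Isℚ z × x <ℚ z × z <ℚ y)
  ℚ-dense x<y = do
    (a , b) , refl , refl , l ← <ℚ⇒≺ x<y
    c , a≺c , c≺b ← mid a b l
    c′ , c≈ , lst ← representative c
    return (code c′ , ⇒Isℚ c′ lst
      , ≺⇒<ℚ a c′ (≺-≈-trans {a} {c} {c′} a≺c c≈)
      , ≺⇒<ℚ c′ b (≈-≺-trans {c′} {c} {b} (sym c≈) c≺b))
    where
    mid : ∀ a b → a ≺ b → ¬ ¬ Σ Frac λ c → a ≺ c × c ≺ b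
    mid a b a≺b = do
      z , p ← ≺⇒Diff {a} {b} a≺b
      let e = z + 1#
          -- The midpoint (a + b) / 2. Its code need not be least, which is why the caller passes to
          -- a representative.
          c = record
            { pos = pos a · den b + pos b · den a
            ; neg = neg a · den b + neg b · den a
            ; den = (1# + 1#) · (den a · den b)
            ; den≢0 = ·≢0 (+≢0 1# 1≢0) (·≢0 (den≢0 a) (den≢0 b)) }
      return (c
        , +-< (e · den a) (·≢0 (suc≢0 z) (den≢0 a)) (trans
            (solve 7 (λ a₁ a₂ a₃ b₁ b₂ b₃ e →
              (a₁ :* (con 2 :* (a₃ :* b₃)) :+ (a₂ :* b₃ :+ b₂ :* a₃) :* a₃) :+ e :* a₃
              := a₁ :* a₃ :* b₃ :+ a₂ :* b₃ :* a₃ :+ ((a₁ :* b₃ :+ b₂ :* a₃) :+ e) :* a₃)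
              refl (pos a) (neg a) (den a) (pos b) (neg b) (den b) e)
            (trans (cong (λ t → pos a · den a · den b + neg a · den b · den a + t · den a) p)
            (solve 6 (λ a₁ a₂ a₃ b₁ b₂ b₃ →
              a₁ :* a₃ :* b₃ :+ a₂ :* b₃ :* a₃ :+ (b₁ :* a₃ :+ a₂ :* b₃) :* a₃
              := (a₁ :* b₃ :+ b₁ :* a₃) :* a₃ :+ a₂ :* (con 2 :* (a₃ :* b₃)))
              refl (pos a) (neg a) (den a) (pos b) (neg b) (den b))))
        , +-< (e · den b) (·≢0 (suc≢0 z) (den≢0 b)) (trans
            (solve 7 (λ a₁ a₂ a₃ b₁ b₂ b₃ e →
              ((a₁ :* b₃ :+ b₁ :* a₃) :* b₃ :+ b₂ :* (con 2 :* (a₃ :* b₃))) :+ e :* b₃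
              := b₁ :* a₃ :* b₃ :+ b₂ :* b₃ :* a₃ :+ ((a₁ :* b₃ :+ b₂ :* a₃) :+ e) :* b₃)
              refl (pos a) (neg a) (den a) (pos b) (neg b) (den b) e)
            (trans (cong (λ t → pos b · den a · den b + neg b · den b · den a + t · den b) p)
            (solve 6 (λ a₁ a₂ a₃ b₁ b₂ b₃ →
              b₁ :* a₃ :* b₃ :+ b₂ :* b₃ :* a₃ :+ (b₁ :* a₃ :+ a₂ :* b₃) :* b₃
              := b₁ :* (con 2 :* (a₃ :* b₃)) :+ (a₂ :* b₃ :+ b₂ :* a₃) :* b₃)
              refl (pos a) (neg a) (den a) (pos b) (neg b) (den b)))))

  ℚ-noLeast : ∀ {x} → Isℚ x → ∃ᶜ[ y ] (Isℚ y × y <ℚ x)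
  ℚ-noLeast h = do
    a , refl , _ ← Isℚ⇒ h
    let c = record { pos = pos a ; neg = neg a + den a ; den = den a ; den≢0 = den≢0 a }
    c′ , c≈ , l ← representative c
    return (code c′ , ⇒Isℚ c′ l , ≺⇒<ℚ c′ a (≈-≺-trans {c′} {c} {a} (sym c≈)
      (+-< (den a · den a) (·≢0 (den≢0 a) (den≢0 a)) (solve 3 (λ m n d →
        m :* d :+ n :* d :+ d :* d := m :* d :+ (n :+ d) :* d) refl (pos a) (neg a) (den a)))))

  ℚ-noGreatest : ∀ {x} → Isℚ x → ∃ᶜ[ y ] (Isℚ y × x <ℚ y)
  ℚ-noGreatest h = do
    a , refl , _ ← Isℚ⇒ h
    let c = record { pos = pos a + den a ; neg = neg a ; den = den a ; den≢0 = den≢0 a }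
    c′ , c≈ , l ← representative c
    return (code c′ , ⇒Isℚ c′ l , ≺⇒<ℚ a c′ (≺-≈-trans {a} {c} {c′}
      (+-< (den a · den a) (·≢0 (den≢0 a) (den≢0 a)) (solve 3 (λ m n d →
        m :* d :+ n :* d :+ d :* d := (m :+ d) :* d :+ n :* d) refl (pos a) (neg a) (den a))) c≈))

  -- Minimality of q quantifies over all fractions, but only one with a code below q could violate
  -- it, and its components are then bounded by q. So the condition is Σ⁰₀.
  ℚ-set : ∃ᶜ[ Q ] (∀ q → (q ∈ Q) ⇔ Isℚ q)
  ℚ-set = do
    Q , h ← comprehension
      (`∃< (v1 `+ `1) ∙ (`∃< (v2 `+ `1) ∙ (`∃< (v3 `+ `1) ∙
        ((v4 `= `⟨ `⟨ v2 , v1 ⟩ , v0 ⟩) `∧ ((`¬ (v0 `= `0)) `∧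
        (`∀< (v4 `+ `1) ∙ (`∀< (v5 `+ `1) ∙ (`∀< (v6 `+ `1) ∙ ((`¬ (v0 `= `0)) `⇒
          ((((v5 `· v0) `+ (v1 `· v3)) `= ((v2 `· v3) `+ (v4 `· v0))) `⇒
            (v7 `< (`⟨ `⟨ v2 , v1 ⟩ , v0 ⟩ `+ `1)))))))))))) [] []
    return (Q , λ q → mk⇔
      (λ q∈Q → do
        m , _ , r ← to (h q) q∈Q
        n , _ , r ← r
        d , _ , q≡ , d≢0 , r ← r
        return (m , return (n , return (d , q≡ , d≢0 , λ m′ n′ d′ d′≢0 p → do
          inj₂ q≮ ← em (frac m′ n′ d′ < q)
            where inj₁ f<q → <suc⇒ (r
                    m′ (<-trans (pos<code+1 m′ n′ d′) (suc-mono-< f<q))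
                    n′ (<-trans (neg<code+1 m′ n′ d′) (suc-mono-< f<q))
                    d′ (<-trans (den<code+1 m′ n′ d′) (suc-mono-< f<q)) d′≢0 p)
          <suc⇒ (≮⇒<suc q≮)))))
      (λ q∈ℚ → from (h q) do
        a , refl , l ← Isℚ⇒ q∈ℚ
        return (pos a , pos<code+1 (pos a) (neg a) (den a) ,
          return (neg a , neg<code+1 (pos a) (neg a) (den a) ,
          return (den a , den<code+1 (pos a) (neg a) (den a) , refl , den≢0 a ,
            λ m′ _ n′ _ d′ _ d′≢0 p → l (record { pos = m′ ; neg = n′ ; den = d′ ; den≢0 = d′≢0 }) p)))))

  <ℚ-set : ∃ᶜ[ L ] (∀ x y → (⟨ x , y ⟩ ∈ L) ⇔ (x <ℚ y))
  <ℚ-set = do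
    L , h ← comprehension₂
      (`∃< (v1 `+ `1) ∙ (`∃< (v2 `+ `1) ∙ (`∃< (v3 `+ `1) ∙
       (`∃< (v3 `+ `1) ∙ (`∃< (v4 `+ `1) ∙ (`∃< (v5 `+ `1) ∙
        ((v7 `= `⟨ `⟨ v5 , v4 ⟩ , v3 ⟩) `∧ ((`¬ (v3 `= `0)) `∧
        ((v6 `= `⟨ `⟨ v2 , v1 ⟩ , v0 ⟩) `∧ ((`¬ (v0 `= `0)) `∧
        (((v5 `· v0) `+ (v1 `· v3)) `< ((v2 `· v3) `+ (v4 `· v0)))))))))))))
      [] []
    return (L , λ x y → mk⇔
      (λ p∈L → do
        m , _ , r ← to (h x y) p∈L
        n , _ , r ← r
        d , _ , r ← r
        m′ , _ , r ← r
        n′ , _ , r ← r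
        d′ , _ , r ← r
        return (m , return (n , return (d , return (m′ , return (n′ , return (d′ , r)))))))
      (λ x<y → from (h x y) do
        (a , b) , refl , refl , l ← <ℚ⇒≺ x<y
        return (pos a , pos<code+1 (pos a) (neg a) (den a) ,
          return (neg a , neg<code+1 (pos a) (neg a) (den a) ,
          return (den a , den<code+1 (pos a) (neg a) (den a) ,
          return (pos b , pos<code+1 (pos b) (neg b) (den b) ,
          return (neg b , neg<code+1 (pos b) (neg b) (den b) ,
          return (den b , den<code+1 (pos b) (neg b) (den b) ,
            refl , den≢0 a , refl , den≢0 b , l))))))))

-- Coding finite sets by divisibility

module FiniteSetCodes (M : L₂-Structure) (rca : RCA₀ M) where
  open Arithmetic M rca
  open Comprehension M rca

  -- The bound on the quotient makes divisibility Σ⁰₀.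
  infix 4 _∣_
  _∣_ : N → N → Set
  d ∣ x = ∃ᶜ[ q ] (q < x + 1# × x ≡ d · q)

  divides : ∀ {d x} q → d ≢ 0# → x ≡ d · q → d ∣ x
  divides {d} q d≢0 refl = do
    w , refl ← ≢0⇒suc d≢0
    return (q , subst (λ t → q < t + 1#) (sym (suc-· w q)) (n<m+n+1 (w · q) q) , refl)

  ∣-·ʳ : ∀ {d x} y → d ≢ 0# → d ∣ x → d ∣ (x · y)
  ∣-·ʳ {d} y d≢0 h = h >>= λ { (q , _ , refl) → divides (q · y) d≢0 (·-assoc d q y) }

  -- The quotient for y is q′ - q, so q′ < q has to be excluded first: it would make d · (z + 1) + y
  -- zero.
  ∣-sub : ∀ {d x y} → d ≢ 0# → d ∣ x → d ∣ (x + y) → d ∣ y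
  ∣-sub {d} {y = y} d≢0 h h′ = do
    q , _ , refl ← h
    q′ , _ , p ← h′
    inj₁ q≤q′ ← em (q < q′ + 1#) where
      inj₂ q≰q′ → ⊥-elim (<⇒∃ (<-stable _ _ λ q′≮q → q≰q′ (≮⇒<suc q′≮q)) λ { (z , refl) →
        +≢0 y (·≢0 d≢0 (suc≢0 z)) (+-cancelʳ _ 0# (d · q′) (trans
          (solve 4 (λ d z y q′ → (d :* (z :+ con 1) :+ y) :+ d :* q′ := d :* (q′ :+ (z :+ con 1)) :+ y) refl d z y q′)
          (trans p (sym (+-identityˡ _))))) })
    r , refl ← <suc⇒∃ q≤q′
    divides r d≢0 (+-cancelʳ _ _ (d · q) (trans (+-comm y _) (trans p
      (solve 3 (λ d q r → d :* (q :+ r) := d :* r :+ d :* q) refl d q r))))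

  ∣-< : ∀ {d t} → t < d → d ∣ t → t ≡ 0#
  ∣-< {d} {t} t<d h = ≡-stable _ _ do
    q , _ , refl ← h
    inj₂ q≢0 ← em (q ≡ 0#) where inj₁ refl → return (·-zero d)
    w , refl ← ≢0⇒suc q≢0
    ⊥-elim (<suc⇒≯ (subst (λ t → d < t + 1#) (sym (·-suc d w)) (n<m+n+1 (d · w) d)) t<d)

  division : ∀ {d} → d ≢ 0# → ∀ x → ∃ᶜ[ q ] ∃ᶜ[ r ] (r < d × x ≡ d · q + r)
  division {d} d≢0 = Σ⁰₁-induction (`∃< v2 ∙ (v2 `= ((v3 `· v1) `+ v0))) (d ∷ []) []
    (do w , refl ← ≢0⇒suc d≢0
        return (0# , return (0# , 0<suc w , sym (trans (+-zero _) (·-zero _)))))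
    (λ a h → do
      q , h ← h
      r , r<d , refl ← h
      inj₁ r+1<d ← em (r + 1# < d) where
        inj₂ r+1≮d → do
          w , refl ← ≢0⇒suc d≢0
          let r≡w = ≡-stable _ _ (<suc⇒ r<d >>= λ
                { (inj₁ r<w) → ⊥-elim (r+1≮d (suc-mono-< r<w)) ; (inj₂ p) → return p })
          return (q + 1# , return (0# , 0<suc w , trans
            (cong (λ t → ((w + 1#) · q + t) + 1#) r≡w)
            (solve 2 (λ w q → ((w :+ con 1) :* q :+ w) :+ con 1 := (w :+ con 1) :* (q :+ con 1) :+ con 0) refl w q)))
      return (q , return (r + 1# , r+1<d , +-assoc _ r 1#)))

  -- k is not a zero divisor modulo d; unlike invertibility this needs no witness, hence is Σ⁰₀.
  Regular : N → N → Set
  Regular k d = ∀ t → t < d → d ∣ (k · t) → t ≡ 0#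

  Regular-1 : ∀ {d} → Regular 1# d
  Regular-1 {d} t t<d h = ∣-< t<d (subst (d ∣_) (·-identityˡ t) h)

  Regular-· : ∀ {k l d} → d ≢ 0# → Regular k d → Regular l d → Regular (k · l) d
  Regular-· {k} {l} {d} d≢0 rk rl t t<d h = ≡-stable _ _ do
    -- `Regular` tests only numbers below d, so l · t is replaced by its remainder.
    q , s ← division d≢0 (l · t)
    r , r<d , p ← s
    let r≡0 = rk r r<d (∣-sub d≢0 (divides (k · q) d≢0 refl)
          (subst (d ∣_) (trans (·-assoc k l t) (trans (cong (k ·_) p)
            (solve 4 (λ k d q r → k :* (d :* q :+ r) := d :* (k :* q) :+ k :* r) refl k d q r))) h))
    return (rl t t<d (divides q d≢0 (trans p (trans (cong (d · q +_) r≡0) (+-zero _)))))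

  -- Gödel's moduli: if 1, ..., n all divide m, those with index below n are pairwise coprime, so a
  -- product of some of them remembers its factors.
  modulus : N → N → N
  modulus m i = m · (i + 1#) + 1#

  modulus≢0 : ∀ m i → modulus m i ≢ 0#
  modulus≢0 m i = suc≢0 _

  modulus-cancel : ∀ m j y → modulus m j ∣ (m · y) → modulus m j ∣ y
  modulus-cancel m j y h = ∣-sub (modulus≢0 m j) (∣-·ʳ (j + 1#) (modulus≢0 m j) h)
    (divides y (modulus≢0 m j) (solve 3 (λ m j y →
      m :* y :* (j :+ con 1) :+ y := (m :* (j :+ con 1) :+ con 1) :* y) refl m j y))

  -- Write m = (e + 1) · u. Multiplying by u turns the number to be divided into m · m · t, from
  -- which m cancels twice.
  modulus-cancel-divisor : ∀ m j e t → (e + 1#) ∣ m → modulus m j ∣ (m · (e + 1#) · t) → modulus m j ∣ t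
  modulus-cancel-divisor m j e t h h′ = h >>= λ { (u , _ , p) →
    modulus-cancel m j t (modulus-cancel m j (m · t) (subst (modulus m j ∣_)
      (trans (solve 4 (λ m e t u → m :* (e :+ con 1) :* t :* u := m :* (((e :+ con 1) :* u) :* t)) refl m e t u)
             (cong (λ s → m · (s · t)) (sym p)))
      (∣-·ʳ u (modulus≢0 m j) h′))) }

  -- modulus m j is coprime to m, hence to the divisor |i − j| of m, and modulus m i − modulus m j = m (i − j).
  Regular-modulus : ∀ {m n i j} → (∀ i → i < n → (i + 1#) ∣ m) → i < n → j < n → i ≢ j →
    Regular (modulus m i) (modulus m j)
  Regular-modulus {m} {n} {i} {j} dvd i<n j<n i≢j t t<d h = ≡-stable _ _ (<-tri i j >>= λ
    { (lt i<j) → <⇒∃ i<j >>= λ { (e , refl) → return (∣-< t<d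
        (modulus-cancel-divisor m j e t (dvd e (<-trans (e< i e) j<n))
          (∣-sub (modulus≢0 m j) h (divides t (modulus≢0 m j)
            (solve 4 (λ m i e t →
              (m :* (i :+ con 1) :+ con 1) :* t :+ m :* (e :+ con 1) :* t
              := (m :* ((i :+ (e :+ con 1)) :+ con 1) :+ con 1) :* t) refl m i e t))))) }
    ; (eq i≡j) → ⊥-elim (i≢j i≡j)
    ; (gt j<i) → <⇒∃ j<i >>= λ { (e , refl) → return (∣-< t<d
        (modulus-cancel-divisor m j e t (dvd e (<-trans (e< j e) i<n))
          (∣-sub (modulus≢0 m j) (divides t (modulus≢0 m j) refl)
            (subst (modulus m j ∣_) (solve 4 (λ m j e t →
              (m :* ((j :+ (e :+ con 1)) :+ con 1) :+ con 1) :* t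
              := (m :* (j :+ con 1) :+ con 1) :* t :+ m :* (e :+ con 1) :* t) refl m j e t) h)))) } })
    where
    e< : ∀ i e → e < i + (e + 1#)
    e< i e = ∃⇒< i (solve 2 (λ i e → i :+ (e :+ con 1) := e :+ (i :+ con 1)) refl i e)

  -- The witness is n!, built by Σ⁰₁ induction since factorial is not a term of the language.
  commonMultiple : ∀ n → ∃ᶜ[ m ] (m ≢ 0# × (∀ i → i < n → (i + 1#) ∣ m))
  commonMultiple = Σ⁰₁-induction
    ((`¬ (v0 `= `0)) `∧ (`∀< v1 ∙ (`∃< (v1 `+ `1) ∙ (v2 `= ((v1 `+ `1) `· v0))))) [] []
    (return (0# + 1# , suc≢0 0# , λ i i<0 → ⊥-elim (≮0 i i<0)))
    (λ a h → do
      m , m≢0 , dvd ← h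
      return (m · (a + 1#) , ·≢0 m≢0 (suc≢0 a) , λ i i<sa → <suc⇒ i<sa >>= λ
        { (inj₁ i<a) → ∣-·ʳ (a + 1#) (suc≢0 i) (dvd i i<a)
        ; (inj₂ refl) → divides m (suc≢0 a) (·-comm m _) }))

  -- Here k is the product of `modulus m i` over the i < n in X. For the other i the induction
  -- carries regularity instead of non-divisibility, because regularity is preserved by products.
  initialSegmentCode : ∀ X n → ∃ᶜ[ m ] ∃ᶜ[ k ] (∀ i → i < n → (i ∈ X) ⇔ (modulus m i ∣ k))
  initialSegmentCode X n = do
    m , m≢0 , dvd ← commonMultiple n
    k , h ← Σ⁰₁-induction
      (`∀< v3 ∙
        ((((v0 `∈ zero) `∧ (v0 `< v2)) `⇒ (`∃< (v1 `+ `1) ∙ (v2 `= (((v4 `· (v1 `+ `1)) `+ `1) `· v0))))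
        `∧ ((`¬ ((v0 `∈ zero) `∧ (v0 `< v2))) `⇒
            (`∀< ((v3 `· (v0 `+ `1)) `+ `1) ∙
              ((`∃< ((v2 `· v0) `+ `1) ∙ ((v3 `· v1) `= (((v5 `· (v2 `+ `1)) `+ `1) `· v0))) `⇒ (v0 `= `0))))))
      (m ∷ n ∷ []) (X ∷ [])
      (return (1# , λ i _ → (λ { (_ , i<0) → ⊥-elim (≮0 i i<0) }) , λ _ → Regular-1))
      (step m dvd) n
    return (m , return (k , λ i i<n → mk⇔
      (λ i∈X → proj₁ (h i i<n) (i∈X , i<n))
      -- If k were regular and divisible by the modulus, the test number 1# would have to vanish.
      (λ d∣k → ∈-stable _ _ λ i∉X → 1≢0
        (proj₂ (h i i<n) (i∉X ∘ proj₁) 1# (1<modulus m i m≢0) (∣-·ʳ 1# (modulus≢0 m i) d∣k)))))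
    where
    1<modulus : ∀ m i → m ≢ 0# → 1# < modulus m i
    1<modulus m i m≢0 = +-< _ (·≢0 m≢0 (suc≢0 i)) (+-comm 1# _)
    Invariant : N → N → N → Set
    Invariant m k a = ∀ i → i < n →
      (i ∈ X × i < a → modulus m i ∣ k) × (¬ (i ∈ X × i < a) → Regular k (modulus m i))
    step : ∀ m → (∀ i → i < n → (i + 1#) ∣ m) →
      ∀ a → ∃ᶜ[ k ] Invariant m k a → ∃ᶜ[ k ] Invariant m k (a + 1#)
    step m dvd a h = do
      k , inv ← h
      -- Factors enter only below n, where the moduli are known to be coprime.
      inj₁ (a∈X , a<n) ← em (a ∈ X × a < n) where
        inj₂ a∉ → return (k , λ i i<n →
          (λ { (i∈X , i<sa) → <suc⇒ i<sa >>= λ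
            { (inj₁ i<a) → proj₁ (inv i i<n) (i∈X , i<a)
            ; (inj₂ refl) → ⊥-elim (a∉ (i∈X , i<n)) } })
          , λ i∉ → proj₂ (inv i i<n) (λ { (i∈X , i<a) → i∉ (i∈X , <⇒<suc i<a) }))
      return (k · modulus m a , λ i i<n →
        (λ { (i∈X , i<sa) → <suc⇒ i<sa >>= λ
          { (inj₁ i<a) → ∣-·ʳ (modulus m a) (modulus≢0 m i) (proj₁ (inv i i<n) (i∈X , i<a))
          ; (inj₂ refl) → divides k (modulus≢0 m i) (·-comm k _) } })
        , λ i∉ → Regular-· (modulus≢0 m i)
            (proj₂ (inv i i<n) (λ { (i∈X , i<a) → i∉ (i∈X , <⇒<suc i<a) }))
            (Regular-modulus dvd a<n i<n (λ { refl → i∉ (a∈X , n<n+1 a) })))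

  -- ⟨ p , c ⟩ ∈ E reads: p belongs to the finite set with code c.
  record IsFiniteMembership (E : 𝒮) : Set where
    field
      -- This turns quantifiers over the members of a coded set into bounded ones.
      ∈⇒<    : ∀ {p c} → ⟨ p , c ⟩ ∈ E → p < c
      empty  : ∃ᶜ[ c ] (∀ p → ¬ (⟨ p , c ⟩ ∈ E))
      adjoin : ∀ c p₀ → ∃ᶜ[ c′ ] (∀ p → (⟨ p , c′ ⟩ ∈ E) ⇔ (⟨ p , c ⟩ ∈ E ∨ p ≡ p₀))

  -- A code is ⟨ ⟨ k , m ⟩ , b ⟩, and p belongs to it when p < b and `modulus m p` divides k. The
  -- bound b is stored because beyond it divisibility could hold by accident.
  finiteMembership : ∃ᶜ[ E ] IsFiniteMembership E
  finiteMembership = do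
    E , h ← comprehension₂
      (`∃< (v0 `+ `1) ∙ (`∃< (v1 `+ `1) ∙ (`∃< (v2 `+ `1) ∙
        ((v3 `= `⟨ `⟨ v2 , v1 ⟩ , v0 ⟩) `∧ ((v4 `< v0) `∧
         (`∃< (v2 `+ `1) ∙ (v3 `= (((v2 `· (v5 `+ `1)) `+ `1) `· v0))))))))
      [] []
    let elim : ∀ p c → ⟨ p , c ⟩ ∈ E → ∃ᶜ[ k ] ∃ᶜ[ m ] ∃ᶜ[ b ]
                 (c ≡ ⟨ ⟨ k , m ⟩ , b ⟩ × p < b × modulus m p ∣ k)
        elim p c p∈c = do
          k , _ , r ← to (h p c) p∈c
          m , _ , r ← r
          b , _ , r ← r
          return (k , return (m , return (b , r)))
        intro : ∀ p k m b → p < b → modulus m p ∣ k → ⟨ p , ⟨ ⟨ k , m ⟩ , b ⟩ ⟩ ∈ E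
        intro p k m b p<b d = from (h p _)
          (return (k , <suc-trans (x<⟨x,y⟩+1 k m) (x<⟨x,y⟩+1 _ b) ,
           return (m , <suc-trans (y<⟨x,y⟩+1 k m) (x<⟨x,y⟩+1 _ b) ,
           return (b , y<⟨x,y⟩+1 _ b , refl , p<b , d))))
        bound : ∀ {p c} → ⟨ p , c ⟩ ∈ E → p < c
        bound {p} {c} p∈c = <-stable _ _ do
          k , r ← elim p c p∈c
          m , r ← r
          b , refl , p<b , _ ← r
          return (<-<suc-trans p<b (y<⟨x,y⟩+1 _ b))
    return (E , record
      { ∈⇒< = bound
      ; empty = return (⟨ ⟨ 0# , 0# ⟩ , 0# ⟩ , λ p p∈ → run do
          k , r ← elim p _ p∈
          m , r ← r
          b , c≡ , p<b , _ ← r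
          ⊥-elim (≮0 p (subst (p <_) (sym (proj₂ (⟨,⟩-injective c≡))) p<b)))
      ; adjoin = λ c p₀ → do
          X , hX ← comprehension ((`⟨ v1 , v2 ⟩ `∈ zero) `∨ (v1 `= v3)) (c ∷ p₀ ∷ []) (E ∷ [])
          -- Larger than p₀ and than every member of c. The enlarged set is coded afresh, since the
          -- multiplier m depends on n.
          let n = (c + p₀) + 1#
          m , r ← initialSegmentCode X n
          k , hk ← r
          return (⟨ ⟨ k , m ⟩ , n ⟩ , λ p → mk⇔
            (λ p∈c′ → do
              k′ , r ← elim p _ p∈c′
              m′ , r ← r
              n′ , c≡ , p<n′ , d ← r
              let e , n≡ = ⟨,⟩-injective c≡
                  k≡ , m≡ = ⟨,⟩-injective e
              to (hX p) (from (hk p (subst (p <_) (sym n≡) p<n′))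
                (subst₂ (λ s t → modulus s p ∣ t) (sym m≡) (sym k≡) d)))
            (λ p∈ → ∈-stable _ _ do
              let p<n = <-stable _ _ (p∈ >>= λ
                    { (inj₁ p∈c) → return (<-trans (bound p∈c) (m<m+n+1 c p₀))
                    ; (inj₂ refl) → return (n<m+n+1 c p₀) })
              return (intro p k m n p<n (to (hk p p<n) (from (hX p) p∈))))) })

-- Dense orders, separation of finite sets, and records

module Orders (M : L₂-Structure) (rca : RCA₀ M) where
  open Arithmetic M rca
  open Comprehension M rca
  open Principles M using (IsInfinite)

  record IsStrictOrder (L : 𝒮) : Set where
    field
      irrefl  : ∀ x → ¬ (⟨ x , x ⟩ ∈ L)
      ≺-trans : ∀ {x y z} → ⟨ x , y ⟩ ∈ L → ⟨ y , z ⟩ ∈ L → ⟨ x , z ⟩ ∈ L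

  Total : 𝒮 → 𝒮 → Set
  Total L D = ∀ {x y} → x ∈ D → y ∈ D → ¬ ¬ (⟨ x , y ⟩ ∈ L ⊎ x ≡ y ⊎ ⟨ y , x ⟩ ∈ L)

  NoGreatest : 𝒮 → 𝒮 → Set
  NoGreatest L D = ∀ {x} → x ∈ D → ∃ᶜ[ y ] (y ∈ D × ⟨ x , y ⟩ ∈ L)

  -- Reversal derives minima from maxima, and left-to-right minima from left-to-right maxima.
  opposite : ∀ L → ∃ᶜ[ Lᵒ ] (∀ x y → (⟨ x , y ⟩ ∈ Lᵒ) ⇔ (⟨ y , x ⟩ ∈ L))
  opposite L = comprehension₂ (`⟨ v0 , v1 ⟩ `∈ zero) [] (L ∷ [])

  module _ {L Lᵒ} (h : ∀ x y → (⟨ x , y ⟩ ∈ Lᵒ) ⇔ (⟨ y , x ⟩ ∈ L)) where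

    opposite-isStrictOrder : IsStrictOrder L → IsStrictOrder Lᵒ
    opposite-isStrictOrder so = record
      { irrefl = λ x p → irrefl x (to (h x x) p)
      ; ≺-trans = λ p q → from (h _ _) (≺-trans (to (h _ _) q) (to (h _ _) p)) }
      where open IsStrictOrder so

    opposite-total : ∀ {D} → Total L D → Total Lᵒ D
    opposite-total tot x∈D y∈D = tot x∈D y∈D >>= λ
      { (inj₁ p) → return (inj₂ (inj₂ (from (h _ _) p)))
      ; (inj₂ (inj₁ p)) → return (inj₂ (inj₁ p))
      ; (inj₂ (inj₂ p)) → return (inj₁ (from (h _ _) p)) }

  -- A running maximum over the codes below n. The starting value a need not itself be below n.
  maximal : ∀ {L} → IsStrictOrder L → ∀ A n a → a ∈ A →
    ∃ᶜ[ u ] (u ∈ A × (∀ r → r < n → r ∈ A → ¬ (⟨ u , r ⟩ ∈ L)))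
  maximal {L} so A n a a∈A = Σ⁰₁-induction
    ((v0 `∈ zero) `∧ (`∀< v1 ∙ ((v0 `∈ zero) `⇒ (`¬ (`⟨ v1 , v0 ⟩ `∈ suc zero))))) [] (A ∷ L ∷ [])
    (return (a , a∈A , λ r r<0 → ⊥-elim (≮0 r r<0)))
    (λ n h → do
      u , u∈A , max ← h
      inj₁ (n∈A , u≺n) ← em (n ∈ A × ⟨ u , n ⟩ ∈ L) where
        inj₂ keep → return (u , u∈A , λ r r<sn r∈A u≺r → <suc⇒ r<sn λ
          { (inj₁ r<n) → max r r<n r∈A u≺r ; (inj₂ refl) → keep (r∈A , u≺r) })
      return (n , n∈A , λ r r<sn r∈A n≺r → <suc⇒ r<sn λ
        { (inj₁ r<n) → max r r<n r∈A (≺-trans u≺n n≺r) ; (inj₂ refl) → irrefl n n≺r }))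
    n
    where open IsStrictOrder so

  minimal : ∀ {L} → IsStrictOrder L → ∀ A n a → a ∈ A →
    ∃ᶜ[ u ] (u ∈ A × (∀ r → r < n → r ∈ A → ¬ (⟨ r , u ⟩ ∈ L)))
  minimal {L} so A n a a∈A = do
    Lᵒ , h ← opposite L
    u , u∈A , max ← maximal (opposite-isStrictOrder h so) A n a a∈A
    return (u , u∈A , λ r r<n r∈A r≺u → max r r<n r∈A (from (h u r) r≺u))

  record IsDLO (L D : 𝒮) : Set where
    field
      isStrictOrder : IsStrictOrder L
      total         : Total L D
      nonempty      : ∃ᶜ[ x ] (x ∈ D)
      dense         : ∀ {x y} → x ∈ D → y ∈ D → ⟨ x , y ⟩ ∈ L →
                      ∃ᶜ[ z ] (z ∈ D × ⟨ x , z ⟩ ∈ L × ⟨ z , y ⟩ ∈ L)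
      noLeast       : ∀ {x} → x ∈ D → ∃ᶜ[ y ] (y ∈ D × ⟨ y , x ⟩ ∈ L)
      noGreatest    : NoGreatest L D
    open IsStrictOrder isStrictOrder public

    ≺-asym : ∀ {x y} → ⟨ x , y ⟩ ∈ L → ¬ (⟨ y , x ⟩ ∈ L)
    ≺-asym p q = irrefl _ (≺-trans p q)

    ⊀-≺-trans : ∀ {x y z} → x ∈ D → y ∈ D → ¬ (⟨ y , x ⟩ ∈ L) → ⟨ y , z ⟩ ∈ L → ⟨ x , z ⟩ ∈ L
    ⊀-≺-trans x∈D y∈D y⊀x y≺z = ∈-stable _ _ (total x∈D y∈D >>= λ
      { (inj₁ x≺y) → return (≺-trans x≺y y≺z)
      ; (inj₂ (inj₁ refl)) → return y≺z
      ; (inj₂ (inj₂ y≺x)) → ⊥-elim (y⊀x y≺x) })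

    ≺-⊀-trans : ∀ {x y z} → y ∈ D → z ∈ D → ⟨ x , y ⟩ ∈ L → ¬ (⟨ z , y ⟩ ∈ L) → ⟨ x , z ⟩ ∈ L
    ≺-⊀-trans y∈D z∈D x≺y z⊀y = ∈-stable _ _ (total y∈D z∈D >>= λ
      { (inj₁ y≺z) → return (≺-trans x≺y y≺z)
      ; (inj₂ (inj₁ refl)) → return x≺y
      ; (inj₂ (inj₂ z≺y)) → ⊥-elim (z⊀y z≺y) })

    -- Density separates the maximum of A from the minimum of B; an empty side is handled by the
    -- absence of endpoints, or by nonemptiness if both are empty. It is applied in Q to extend the
    -- map and in S to find preimages.
    between : ∀ A B n →
      (∀ a → a ∈ A → a ∈ D × a < n) → (∀ b → b ∈ B → b ∈ D × b < n) →
      (∀ a b → a ∈ A → b ∈ B → ⟨ a , b ⟩ ∈ L) →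
      ∃ᶜ[ q ] (q ∈ D × (∀ a → a ∈ A → ⟨ a , q ⟩ ∈ L) × (∀ b → b ∈ B → ⟨ q , b ⟩ ∈ L))
    between A B n A⊆ B⊆ A≺B = em (Σ N (_∈ A)) >>= λ
      { (inj₁ (a , a∈A)) → do
          u , u∈A , max ← maximal isStrictOrder A n a a∈A
          let below : ∀ q → ⟨ u , q ⟩ ∈ L → ∀ a → a ∈ A → ⟨ a , q ⟩ ∈ L
              below q u≺q a a∈A = ⊀-≺-trans (proj₁ (A⊆ a a∈A)) (proj₁ (A⊆ u u∈A))
                (max a (proj₂ (A⊆ a a∈A)) a∈A) u≺q
          inj₁ (b , b∈B) ← em (Σ N (_∈ B)) where
            inj₂ ∅ → do
              q , q∈D , u≺q ← noGreatest (proj₁ (A⊆ u u∈A))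
              return (q , q∈D , below q u≺q , λ b b∈B → ⊥-elim (∅ (b , b∈B)))
          v , v∈B , min ← minimal isStrictOrder B n b b∈B
          q , q∈D , u≺q , q≺v ← dense (proj₁ (A⊆ u u∈A)) (proj₁ (B⊆ v v∈B)) (A≺B u v u∈A v∈B)
          return (q , q∈D , below q u≺q , above v v∈B min q q≺v)
      ; (inj₂ ∅) → do
          inj₁ (b , b∈B) ← em (Σ N (_∈ B)) where
            inj₂ ∅′ → do
              q , q∈D ← nonempty
              return (q , q∈D , (λ a a∈A → ⊥-elim (∅ (a , a∈A))) , λ b b∈B → ⊥-elim (∅′ (b , b∈B)))
          v , v∈B , min ← minimal isStrictOrder B n b b∈B
          q , q∈D , q≺v ← noLeast (proj₁ (B⊆ v v∈B))
          return (q , q∈D , (λ a a∈A → ⊥-elim (∅ (a , a∈A))) , above v v∈B min q q≺v) }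
      where
      above : ∀ v → v ∈ B → (∀ r → r < n → r ∈ B → ¬ (⟨ r , v ⟩ ∈ L)) →
        ∀ q → ⟨ q , v ⟩ ∈ L → ∀ b → b ∈ B → ⟨ q , b ⟩ ∈ L
      above v v∈B min q q≺v b b∈B = ≺-⊀-trans (proj₁ (B⊆ v v∈B)) (proj₁ (B⊆ b b∈B)) q≺v
        (min b (proj₂ (B⊆ b b∈B)) b∈B)

  -- On two records L and the order of the codes always agree, so the records are homogeneous for
  -- Sierpiński's colouring.
  IsRecord : 𝒮 → 𝒮 → N → Set
  IsRecord L S x = x ∈ S × (∀ y → y < x → y ∈ S → ⟨ y , x ⟩ ∈ L)

  -- The least code of an upper bound of S ∩ [0, n] is a record larger than n.
  records : ∀ {L S} → IsStrictOrder L → Total L S → ∃ᶜ[ x ] (x ∈ S) → NoGreatest L S →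
    ∃ᶜ[ T ] ((∀ x → (x ∈ T) ⇔ IsRecord L S x) × IsInfinite T)
  records {L} {S} so tot ne ng = do
    T , hT ← comprehension ((v1 `∈ zero) `∧ (`∀< v1 ∙ ((v0 `∈ zero) `⇒ (`⟨ v0 , v2 ⟩ `∈ suc zero))))
               [] (S ∷ L ∷ [])
    return (T , hT , λ n → do
      X , hX ← comprehension
        ((v1 `∈ zero) `∧ (`∀< (v2 `+ `1) ∙ ((v0 `∈ zero) `⇒ (`⟨ v0 , v2 ⟩ `∈ suc zero)))) (n ∷ []) (S ∷ L ∷ [])
      x , x∈S , x-bounds ← bounds (n + 1#)
      m , m∈X , below ← least X x (from (hX x) (x∈S , x-bounds))
      let m∈S , m-bounds = to (hX m) m∈X
          -- Otherwise m would be among the elements it bounds, hence below itself.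
          n<m = <-stable _ _ λ n≮m → irrefl m (m-bounds m (≮⇒<suc n≮m) m∈S)
      -- An earlier y in S that is not below m would itself bound S ∩ [0, n], against the leastness
      -- of m.
      return (m , n<m , from (hT m) (m∈S , λ y y<m y∈S → ∈-stable _ _ λ y⊀m →
        below y y<m (from (hX y) (y∈S , λ z z≤n z∈S → ∈-stable _ _ (tot z∈S y∈S >>= λ
          { (inj₁ z≺y) → return z≺y
          ; (inj₂ (inj₁ refl)) → ⊥-elim (y⊀m (m-bounds z z≤n z∈S))
          ; (inj₂ (inj₂ y≺z)) → ⊥-elim (y⊀m (≺-trans y≺z (m-bounds z z≤n z∈S))) }))))))
    where
    open IsStrictOrder so
    bounds : ∀ n → ∃ᶜ[ x ] (x ∈ S × (∀ y → y < n → y ∈ S → ⟨ y , x ⟩ ∈ L))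
    bounds = Σ⁰₁-induction ((v0 `∈ zero) `∧ (`∀< v1 ∙ ((v0 `∈ zero) `⇒ (`⟨ v0 , v1 ⟩ `∈ suc zero)))) [] (S ∷ L ∷ [])
      (ne >>= λ { (x , x∈S) → return (x , x∈S , λ y y<0 → ⊥-elim (≮0 y y<0)) })
      (λ n h → do
        x , x∈S , bd ← h
        inj₁ n∈S ← em (n ∈ S) where
          inj₂ n∉S → return (x , x∈S , λ y y<sn y∈S → ∈-stable _ _ (<suc⇒ y<sn >>= λ
            { (inj₁ y<n) → return (bd y y<n y∈S) ; (inj₂ refl) → ⊥-elim (n∉S y∈S) }))
        m , m∈S , x≼m , n≼m ← upper x∈S n∈S
        z , z∈S , m≺z ← ng m∈S
        return (z , z∈S , λ y y<sn y∈S → ∈-stable _ _ (<suc⇒ y<sn >>= λ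
          { (inj₁ y<n) → return (≺-trans (x≼m y (bd y y<n y∈S)) m≺z)
          ; (inj₂ refl) → return (n≼m z m≺z) })))
      where
      upper : ∀ {x n} → x ∈ S → n ∈ S → ¬ ¬ Σ N λ m → m ∈ S ×
        (∀ z → ⟨ z , x ⟩ ∈ L → ⟨ z , m ⟩ ∈ L) × (∀ z → ⟨ m , z ⟩ ∈ L → ⟨ n , z ⟩ ∈ L)
      upper {x} {n} x∈S n∈S = tot x∈S n∈S >>= λ
        { (inj₁ x≺n) → return (n , n∈S , (λ _ p → ≺-trans p x≺n) , λ _ → id)
        ; (inj₂ (inj₁ refl)) → return (n , n∈S , (λ _ → id) , λ _ → id)
        ; (inj₂ (inj₂ n≺x)) → return (x , x∈S , (λ _ → id) , λ _ → ≺-trans n≺x) }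

-- The greedy isomorphism between two dense orders

module ForthMap (M : L₂-Structure) (rca : RCA₀ M) where
  open Arithmetic M rca
  open Comprehension M rca
  open FiniteSetCodes M rca
  open Orders M rca

  module _ {L E S Q : 𝒮} (fm : IsFiniteMembership E) (dloS : IsDLO L S) (dloQ : IsDLO L Q) where
    open IsFiniteMembership fm
    module S = IsDLO dloS
    module Q = IsDLO dloQ

    infix 4 _≺_
    _≺_ : N → N → Set
    x ≺ y = ⟨ x , y ⟩ ∈ L

    _↦_∈ᶠ_ : N → N → N → Set
    x ↦ q ∈ᶠ c = ⟨ ⟨ x , q ⟩ , c ⟩ ∈ E

    ↦∈ᶠ⇒< : ∀ {x q c} → x ↦ q ∈ᶠ c → x < c × q < c
    ↦∈ᶠ⇒< {x} {q} h = <suc-<-trans (x<⟨x,y⟩+1 x q) (∈⇒< h) , <suc-<-trans (y<⟨x,y⟩+1 x q) (∈⇒< h)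

    -- Only points with smaller code are consulted, so the condition on x is unaffected when later
    -- points are added to c.
    Cut : N → N → N → Set
    Cut x q c = ∀ y r → y < x → y ↦ r ∈ᶠ c → (y ≺ x → r ≺ q) × (x ≺ y → q ≺ r)

    record Stage (a c : N) : Set where
      field
        onlyPairs : ∀ p → ⟨ p , c ⟩ ∈ E → ∃ᶜ[ x ] ∃ᶜ[ q ] (p ≡ ⟨ x , q ⟩)
        domain    : ∀ {x q} → x ↦ q ∈ᶠ c → x < a
        source    : ∀ {x q} → x ↦ q ∈ᶠ c → x ∈ S
        target    : ∀ {x q} → x ↦ q ∈ᶠ c → q ∈ Q
        cut       : ∀ {x q} → x ↦ q ∈ᶠ c → Cut x q c
        leastCut  : ∀ {x q} → x ↦ q ∈ᶠ c → ∀ r → r < q → r ∈ Q → ¬ Cut x r c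
        defined   : ∀ x → x < a → x ∈ S → ∃ᶜ[ q ] (x ↦ q ∈ᶠ c)
    open Stage

    cut-set : ∃ᶜ[ C ] (∀ x q c → (⟨ ⟨ x , q ⟩ , c ⟩ ∈ C) ⇔ Cut x q c)
    cut-set = do
      C , _ , h ← comprehension₃
        (`∀< v2 ∙ (`∀< v1 ∙ ((`⟨ `⟨ v1 , v0 ⟩ , v2 ⟩ `∈ zero) `⇒
          (((`⟨ v1 , v4 ⟩ `∈ suc zero) `⇒ (`⟨ v0 , v3 ⟩ `∈ suc zero)) `∧
           ((`⟨ v4 , v1 ⟩ `∈ suc zero) `⇒ (`⟨ v3 , v0 ⟩ `∈ suc zero)))))) [] (E ∷ L ∷ [])
      return (C , λ x q c → mk⇔
        (λ p y r y<x m → to (h x q c) p y y<x r (proj₂ (↦∈ᶠ⇒< m)) m)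
        (λ p → from (h x q c) λ y y<x r _ m → p y r y<x m))

    -- Members of a coded set are below its code, so being a stage is Σ⁰₀. As a set parameter it can
    -- enter the Σ⁰₁ induction for existence and the Δ⁰₁ definition of the limit.
    stage-set : ∃ᶜ[ P ] (∀ a c → (⟨ a , c ⟩ ∈ P) ⇔ Stage a c)
    stage-set = do
      C , hC ← cut-set
      P , h ← comprehension₂
        ((`∀< v0 ∙ ((`⟨ v0 , v1 ⟩ `∈ zero) `⇒ (`∃< v2 ∙ (`∃< v2 ∙
            ((v2 `= `⟨ v1 , v0 ⟩) `∧ ((v1 `∈ suc (suc zero)) `∧ ((v0 `∈ suc (suc (suc zero))) `∧
            ((`⟨ `⟨ v1 , v0 ⟩ , v3 ⟩ `∈ suc zero) `∧
            (`∀< v0 ∙ ((v0 `∈ suc (suc (suc zero))) `⇒ (`¬ (`⟨ `⟨ v2 , v0 ⟩ , v4 ⟩ `∈ suc zero))))))))))))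
         `∧ (`∀< v1 ∙ ((v0 `∈ suc (suc zero)) `⇒ (`∃< v1 ∙ (`⟨ `⟨ v1 , v0 ⟩ , v2 ⟩ `∈ zero)))))
        [] (E ∷ C ∷ S ∷ Q ∷ [])
      let elim : ∀ a c → ⟨ a , c ⟩ ∈ P → ∀ {x q} → x ↦ q ∈ᶠ c →
            ¬ ¬ (x < a × x ∈ S × q ∈ Q × Cut x q c × (∀ r → r < q → r ∈ Q → ¬ Cut x r c))
          elim a c p {x} {q} m = do
            x′ , x′<a , s ← proj₁ (to (h a c) p) ⟨ x , q ⟩ (∈⇒< m) m
            q′ , _ , e , x′∈S , q′∈Q , ct , lc ← s
            let x≡ , q≡ = ⟨,⟩-injective e
            return (subst₂ (λ x q → x < a × x ∈ S × q ∈ Q × Cut x q c ×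
                (∀ r → r < q → r ∈ Q → ¬ Cut x r c)) (sym x≡) (sym q≡)
              ( x′<a , x′∈S , q′∈Q , to (hC _ _ _) ct
              , λ r r<q r∈Q ct′ → lc r r<q r∈Q (from (hC _ _ _) ct′)))
      return (P , λ a c → mk⇔
        (λ p → record
          { onlyPairs = λ w w∈c → do
              x , _ , s ← proj₁ (to (h a c) p) w (∈⇒< w∈c) w∈c
              q , _ , e , _ ← s
              return (x , return (q , e))
          ; domain = λ m → <-stable _ _ (elim a c p m >>= λ { (t , _) → return t })
          ; source = λ m → ∈-stable _ _ (elim a c p m >>= λ { (_ , t , _) → return t })
          ; target = λ m → ∈-stable _ _ (elim a c p m >>= λ { (_ , _ , t , _) → return t })
          ; cut = λ m y r y<x m′ →
              (λ l → ∈-stable _ _ (elim a c p m >>= λ { (_ , _ , _ , t , _) → return (proj₁ (t y r y<x m′) l) }))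
            , (λ l → ∈-stable _ _ (elim a c p m >>= λ { (_ , _ , _ , t , _) → return (proj₂ (t y r y<x m′) l) }))
          ; leastCut = λ m r r<q r∈Q ct → elim a c p m λ { (_ , _ , _ , _ , t) → t r r<q r∈Q ct }
          ; defined = λ x x<a x∈S → do
              q , _ , m ← proj₂ (to (h a c) p) x x<a x∈S
              return (q , m) })
        (λ st → from (h a c)
          ( (λ w _ w∈c → do
              x , s ← onlyPairs st w w∈c
              q , refl ← s
              return (x , domain st w∈c , return (q , proj₂ (↦∈ᶠ⇒< w∈c) , refl , source st w∈c , target st w∈c
                , from (hC _ _ _) (cut st w∈c)
                , λ r r<q r∈Q ct → leastCut st w∈c r r<q r∈Q (to (hC _ _ _) ct))))
          , λ x x<a x∈S → do
              q , m ← defined st x x<a x∈S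
              return (q , proj₂ (↦∈ᶠ⇒< m) , m))))

    -- By strong induction the two stages agree below x; then q and q′ are least for the same cut.
    stage-unique : ∀ {a c a′ c′} → Stage a c → Stage a′ c′ →
      ∀ {x q q′} → x ↦ q ∈ᶠ c → x ↦ q′ ∈ᶠ c′ → q ≡ q′
    stage-unique {a} {c} {a′} {c′} st st′ {x} {q} {q′} m m′ = strongInduction
      (`∀< v2 ∙ (`∀< v4 ∙ ((`⟨ `⟨ v3 , v1 ⟩ , v4 ⟩ `∈ zero) `⇒
        ((`⟨ `⟨ v3 , v0 ⟩ , v5 ⟩ `∈ zero) `⇒ (v1 `= v0))))) (c ∷ c′ ∷ []) (E ∷ [])
      (λ x ih q _ q′ _ m m′ →
        let agree  : ∀ {y r} → y < x → y ↦ r ∈ᶠ c → y ↦ r ∈ᶠ c′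
            agree y<x n = ∈-stable _ _ (defined st′ _ (<-trans y<x (domain st′ m′)) (source st n) >>= λ
              { (r′ , n′) → return (subst (λ t → _ ↦ t ∈ᶠ c′)
                  (sym (ih _ y<x _ (proj₂ (↦∈ᶠ⇒< n)) r′ (proj₂ (↦∈ᶠ⇒< n′)) n n′)) n′) })
            agree′ : ∀ {y r} → y < x → y ↦ r ∈ᶠ c′ → y ↦ r ∈ᶠ c
            agree′ y<x n′ = ∈-stable _ _ (defined st _ (<-trans y<x (domain st m)) (source st′ n′) >>= λ
              { (r , n) → return (subst (λ t → _ ↦ t ∈ᶠ c)
                  (ih _ y<x r (proj₂ (↦∈ᶠ⇒< n)) _ (proj₂ (↦∈ᶠ⇒< n′)) n n′) n) })
        in ≡-stable _ _ (<-tri q q′ >>= λ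
          { (lt q<q′) → ⊥-elim (leastCut st′ m′ q q<q′ (target st m)
              (λ y r y<x n → cut st m y r y<x (agree′ y<x n)))
          ; (eq p) → return p
          ; (gt q′<q) → ⊥-elim (leastCut st m q′ q′<q (target st′ m′)
              (λ y r y<x n → cut st′ m′ y r y<x (agree y<x n))) }))
      x q (proj₂ (↦∈ᶠ⇒< m)) q′ (proj₂ (↦∈ᶠ⇒< m′)) m m′

    -- Each comparison is recorded in the cut of whichever point has the larger code.
    stage-mono : ∀ {a c} → Stage a c → ∀ {x q x′ q′} → x ↦ q ∈ᶠ c → x′ ↦ q′ ∈ᶠ c → x ≺ x′ → q ≺ q′
    stage-mono st {x} {q} {x′} {q′} m m′ x≺x′ = ∈-stable _ _ (<-tri x x′ >>= λ
      { (lt x<x′) → return (proj₁ (cut st m′ x q x<x′ m) x≺x′)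
      ; (eq refl) → ⊥-elim (S.irrefl x x≺x′)
      ; (gt x′<x) → return (proj₂ (cut st m x′ q′ x′<x m′) x≺x′) })

    cut-exists : ∀ {a c} → Stage a c → a ∈ S → ∃ᶜ[ q ] (q ∈ Q × Cut a q c)
    cut-exists {a} {c} st a∈S = do
      A , hA ← comprehension (`∃< v2 ∙ ((`⟨ `⟨ v0 , v2 ⟩ , v3 ⟩ `∈ zero) `∧ (`⟨ v0 , v4 ⟩ `∈ suc zero)))
                 (c ∷ a ∷ []) (E ∷ L ∷ [])
      B , hB ← comprehension (`∃< v2 ∙ ((`⟨ `⟨ v0 , v2 ⟩ , v3 ⟩ `∈ zero) `∧ (`⟨ v4 , v0 ⟩ `∈ suc zero)))
                 (c ∷ a ∷ []) (E ∷ L ∷ [])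
      q , q∈Q , A≺q , q≺B ← Q.between A B c
        (λ r r∈A → ∈-stable _ _ (to (hA r) r∈A >>= λ { (_ , _ , m , _) → return (target st m) })
                 , <-stable _ _ (to (hA r) r∈A >>= λ { (_ , _ , m , _) → return (proj₂ (↦∈ᶠ⇒< m)) }))
        (λ r r∈B → ∈-stable _ _ (to (hB r) r∈B >>= λ { (_ , _ , m , _) → return (target st m) })
                 , <-stable _ _ (to (hB r) r∈B >>= λ { (_ , _ , m , _) → return (proj₂ (↦∈ᶠ⇒< m)) }))
        (λ r r′ r∈A r′∈B → ∈-stable _ _ do
          y , _ , m , y≺a ← to (hA r) r∈A
          y′ , _ , m′ , a≺y′ ← to (hB r′) r′∈B
          return (stage-mono st m m′ (S.≺-trans y≺a a≺y′)))
      return (q , q∈Q , λ y r _ m →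
          (λ y≺a → A≺q r (from (hA r) (return (y , proj₁ (↦∈ᶠ⇒< m) , m , y≺a))))
        , (λ a≺y → q≺B r (from (hB r) (return (y , proj₁ (↦∈ᶠ⇒< m) , m , a≺y)))))

    stage-extend : ∀ {a c} → Stage a c → a ∈ S → ∃ᶜ[ c′ ] Stage (a + 1#) c′
    stage-extend {a} {c} st a∈S = do
      C , hC ← cut-set
      X , hX ← comprehension ((v1 `∈ zero) `∧ (`⟨ `⟨ v2 , v1 ⟩ , v3 ⟩ `∈ suc zero)) (a ∷ c ∷ []) (Q ∷ C ∷ [])
      q₀ , q₀∈Q , ct₀ ← cut-exists st a∈S
      q , q∈X , below ← least X q₀ (from (hX q₀) (q₀∈Q , from (hC a q₀ c) ct₀))
      c′ , h ← adjoin c ⟨ a , q ⟩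
      let q∈Q , q∈C = to (hX q) q∈X
          new : a ↦ q ∈ᶠ c′
          new = from (h _) (return (inj₂ refl))
          inject : ∀ {y r} → y ↦ r ∈ᶠ c → y ↦ r ∈ᶠ c′
          inject m = from (h _) (return (inj₁ m))
          restrict : ∀ {y r} → y < a → y ↦ r ∈ᶠ c′ → y ↦ r ∈ᶠ c
          restrict y<a m = ∈-stable _ _ (to (h _) m >>= λ
            { (inj₁ n) → return n
            ; (inj₂ e) → ⊥-elim (<-irrefl (subst (_< a) (proj₁ (⟨,⟩-injective e)) y<a)) })
          -- The new pair sits at a, and a cut for x ≤ a looks only strictly below x.
          cut↑ : ∀ {x q} → x < a + 1# → Cut x q c → Cut x q c′
          cut↑ x≤a ct y r y<x m = ct y r y<x (restrict (<-<suc-trans y<x x≤a) m)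
          cut↓ : ∀ {x q} → Cut x q c′ → Cut x q c
          cut↓ ct y r y<x m = ct y r y<x (inject m)
          cases : ∀ {x r} {P : N → N → Set} → (∀ {x r} → ¬ ¬ P x r → P x r) →
            (x ↦ r ∈ᶠ c → P x r) → P a q → x ↦ r ∈ᶠ c′ → P x r
          cases {P = P} stable old fresh m = stable (to (h _) m >>= λ
            { (inj₁ n) → return (old n)
            ; (inj₂ e) → return (subst₂ P (sym (proj₁ (⟨,⟩-injective e))) (sym (proj₂ (⟨,⟩-injective e))) fresh) })
          domain′ : ∀ {x r} → x ↦ r ∈ᶠ c′ → x < a + 1#
          domain′ = cases {P = λ x r → x < a + 1#} (<-stable _ _) (λ n → <⇒<suc (domain st n)) (n<n+1 a)
      return (c′ , record
        { onlyPairs = λ p p∈c′ → to (h p) p∈c′ >>= λ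
            { (inj₁ p∈c) → onlyPairs st p p∈c
            ; (inj₂ e) → return (a , return (q , e)) }
        ; domain = domain′
        ; source = cases {P = λ x r → x ∈ S} (∈-stable _ _) (source st) a∈S
        ; target = cases {P = λ x r → r ∈ Q} (∈-stable _ _) (target st) q∈Q
        ; cut = λ m → cut↑ (domain′ m) (cases {P = λ x r → Cut x r c}
            (λ s y r y<x n → (λ l → ∈-stable _ _ (s >>= λ t → return (proj₁ (t y r y<x n) l)))
                           , (λ l → ∈-stable _ _ (s >>= λ t → return (proj₂ (t y r y<x n) l))))
            (cut st) (to (hC a q c) q∈C) m)
        ; leastCut = λ m r r<q r∈Q ct → cases {P = λ x q → ∀ r → r < q → r ∈ Q → ¬ Cut x r c}
            (λ s r r<q r∈Q ct → s λ t → t r r<q r∈Q ct)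
            (leastCut st)
            (λ r r<q r∈Q ct → below r r<q (from (hX r) (r∈Q , from (hC a r c) ct)))
            m r r<q r∈Q (cut↓ ct)
        ; defined = λ x x<sa x∈S → <suc⇒ x<sa >>= λ
            { (inj₁ x<a) → defined st x x<a x∈S >>= λ { (r , n) → return (r , inject n) }
            ; (inj₂ refl) → return (q , new) } })

    stage-exists : ∀ a → ∃ᶜ[ c ] Stage a c
    stage-exists a = do
      P , hP ← stage-set
      c , c∈P ← Σ⁰₁-induction (`⟨ v1 , v0 ⟩ `∈ zero) [] (P ∷ [])
        (empty >>= λ { (c , ∅) → return (c , from (hP 0# c) record
          { onlyPairs = λ p m → ⊥-elim (∅ _ m)
          ; domain = λ m → ⊥-elim (∅ _ m)
          ; source = λ m → ⊥-elim (∅ _ m)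
          ; target = λ m → ⊥-elim (∅ _ m)
          ; cut = λ m → ⊥-elim (∅ _ m)
          ; leastCut = λ m → ⊥-elim (∅ _ m)
          ; defined = λ x x<0 → ⊥-elim (≮0 x x<0) }) })
        (λ a h → do
          c , c∈P ← h
          let st = to (hP a c) c∈P
          inj₁ a∈S ← em (a ∈ S) where
            inj₂ a∉S → return (c , from (hP _ _) record
              { onlyPairs = onlyPairs st
              ; domain = λ m → <⇒<suc (domain st m)
              ; source = source st
              ; target = target st
              ; cut = cut st
              ; leastCut = leastCut st
              ; defined = λ x x<sa x∈S → <suc⇒ x<sa >>= λ
                  { (inj₁ x<a) → defined st x x<a x∈S
                  ; (inj₂ refl) → ⊥-elim (a∉S x∈S) } })
          c′ , st′ ← stage-extend st a∈S
          return (c′ , from (hP _ _) st′))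
        a
      return (c , to (hP a c) c∈P)

    IsGraph : 𝒮 → Set
    IsGraph G = (∀ p → p ∈ G → ∃ᶜ[ x ] ∃ᶜ[ q ] (p ≡ ⟨ x , q ⟩))
      × (∀ x q → (⟨ x , q ⟩ ∈ G) ⇔ (∃ᶜ[ c ] (Stage (x + 1#) c × x ↦ q ∈ᶠ c)))

    -- Membership is "some stage of length x + 1 has the pair" in Σ⁰₁ form and "every such stage has
    -- it" in Π⁰₁ form. They are equivalent because such a stage exists and its values are unique.
    graph : ∃ᶜ[ G ] IsGraph G
    graph = do
      P , hP ← stage-set
      G , hG ← Δ⁰₁-comprehension
        (`∃< (v1 `+ `1) ∙ (`∃< (v2 `+ `1) ∙ ((v3 `= `⟨ v1 , v0 ⟩) `∧
          ((`⟨ v1 `+ `1 , v2 ⟩ `∈ suc zero) `∧ (`⟨ v3 , v2 ⟩ `∈ zero)))))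
        (`∃< (v1 `+ `1) ∙ (`∃< (v2 `+ `1) ∙ ((v3 `= `⟨ v1 , v0 ⟩) `∧
          ((v1 `∈ suc (suc zero)) `∧ ((`⟨ v1 `+ `1 , v2 ⟩ `∈ suc zero) `⇒ (`⟨ v3 , v2 ⟩ `∈ zero))))))
        [] (E ∷ P ∷ S ∷ [])
        (λ p → mk⇔
          (λ h c′ → do
            c , h ← h
            x , x< , h ← h
            q , q< , refl , c∈P , m ← h
            let st = to (hP _ _) c∈P
            return (x , x< , return (q , q< , refl , source st m , λ c′∈P → ∈-stable _ _ do
              let st′ = to (hP _ _) c′∈P
              q′ , m′ ← defined st′ x (n<n+1 x) (source st m)
              return (subst (λ t → x ↦ t ∈ᶠ c′) (stage-unique st′ st m′ m) m′))))
          (λ h → do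
            -- The instance at 0# is used to decode p as a pair, which has to be known before a
            -- stage of length x + 1 can be chosen.
            x , x< , h₀ ← h 0#
            q , q< , refl , x∈S , _ ← h₀
            c , st ← stage-exists (x + 1#)
            x′ , _ , h₁ ← h c
            q′ , _ , e , _ , f ← h₁
            let x≡ , _ = ⟨,⟩-injective e
            return (c , return (x , x< , return (q , q< , refl , from (hP _ _) st
              , f (subst (λ t → ⟨ t + 1# , c ⟩ ∈ P) x≡ (from (hP _ _) st)))))))
      return (G
        , (λ p p∈G → do
            c , h ← to (hG p) p∈G
            x , _ , h ← h
            q , _ , e , _ ← h
            return (x , return (q , e)))
        , λ x q → mk⇔
          (λ p∈G → do
            c , h ← to (hG _) p∈G
            x′ , _ , h ← h
            q′ , _ , e , c∈P , m ← h
            let x≡ , _ = ⟨,⟩-injective e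
            return (c , to (hP _ _) (subst (λ t → ⟨ t + 1# , c ⟩ ∈ P) (sym x≡) c∈P) , m))
          (λ h → from (hG _) do
            c , st , m ← h
            return (c , return (x , x<⟨x,y⟩+1 x q , return (q , y<⟨x,y⟩+1 x q , refl , from (hP _ _) st , m)))))

    -- The limit map is an order isomorphism

    module Graph {G : 𝒮} (isGraph : IsGraph G) where

      infix 4 _↦_
      _↦_ : N → N → Set
      x ↦ q = ⟨ x , q ⟩ ∈ G

      ↦⇒∈ᶠ : ∀ {a c x q} → Stage a c → x < a → x ↦ q → x ↦ q ∈ᶠ c
      ↦⇒∈ᶠ {c = c} {x} {q} st x<a h = ∈-stable _ _ do
        c₀ , st₀ , m₀ ← to (proj₂ isGraph x q) h
        q′ , m ← defined st x x<a (source st₀ m₀)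
        return (subst (λ t → x ↦ t ∈ᶠ c) (stage-unique st st₀ m m₀) m)

      ∈ᶠ⇒↦ : ∀ {a c x q} → Stage a c → x ↦ q ∈ᶠ c → x ↦ q
      ∈ᶠ⇒↦ {x = x} {q} st m = ∈-stable _ _ do
        c₀ , st₀ ← stage-exists (x + 1#)
        q′ , m₀ ← defined st₀ x (n<n+1 x) (source st m)
        return (from (proj₂ isGraph x q)
          (return (c₀ , st₀ , subst (λ t → x ↦ t ∈ᶠ c₀) (stage-unique st₀ st m₀ m) m₀)))

      ↦-source : ∀ {x q} → x ↦ q → x ∈ S
      ↦-source h = ∈-stable _ _ (to (proj₂ isGraph _ _) h >>= λ { (c , st , m) → return (source st m) })

      ↦-target : ∀ {x q} → x ↦ q → q ∈ Q
      ↦-target h = ∈-stable _ _ (to (proj₂ isGraph _ _) h >>= λ { (c , st , m) → return (target st m) })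

      ↦-total : ∀ {x} → x ∈ S → ∃ᶜ[ q ] (x ↦ q)
      ↦-total {x} x∈S = do
        c , st ← stage-exists (x + 1#)
        q , m ← defined st x (n<n+1 x) x∈S
        return (q , ∈ᶠ⇒↦ st m)

      ↦-functional : ∀ {x q q′} → x ↦ q → x ↦ q′ → q ≡ q′
      ↦-functional {x} h h′ = ≡-stable _ _ do
        c , st ← stage-exists (x + 1#)
        return (stage-unique st st (↦⇒∈ᶠ st (n<n+1 x) h) (↦⇒∈ᶠ st (n<n+1 x) h′))

      ↦-mono : ∀ {x q x′ q′} → x ↦ q → x′ ↦ q′ → x ≺ x′ → q ≺ q′
      ↦-mono {x} {x′ = x′} h h′ x≺x′ = ∈-stable _ _ do
        c , st ← stage-exists ((x + x′) + 1#)
        return (stage-mono st (↦⇒∈ᶠ st (m<m+n+1 x x′) h) (↦⇒∈ᶠ st (n<m+n+1 x x′) h′) x≺x′)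

      ↦-reflects : ∀ {x q x′ q′} → x ↦ q → x′ ↦ q′ → q ≺ q′ → x ≺ x′
      ↦-reflects {x} {q} h h′ q≺q′ = ∈-stable _ _ (S.total (↦-source h) (↦-source h′) >>= λ
        { (inj₁ x≺x′) → return x≺x′
        ; (inj₂ (inj₁ refl)) → ⊥-elim (Q.irrefl q (subst (q ≺_) (↦-functional h′ h) q≺q′))
        ; (inj₂ (inj₂ x′≺x)) → ⊥-elim (Q.≺-asym q≺q′ (↦-mono h′ h x′≺x)) })

      ↦-injective : ∀ {x x′ q} → x ↦ q → x′ ↦ q → x ≡ x′
      ↦-injective {q = q} h h′ = ≡-stable _ _ (S.total (↦-source h) (↦-source h′) >>= λ
        { (inj₁ x≺x′) → ⊥-elim (Q.irrefl q (↦-mono h h′ x≺x′))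
        ; (inj₂ (inj₁ e)) → return e
        ; (inj₂ (inj₂ x′≺x)) → ⊥-elim (Q.irrefl q (↦-mono h′ h x′≺x)) })

      ↦-least : ∀ {x q} → x ↦ q → ∀ r → r < q → r ∈ Q →
        ¬ (∀ y s → y < x → y ↦ s → (y ≺ x → s ≺ r) × (x ≺ y → r ≺ s))
      ↦-least {x} {q} h r r<q r∈Q ct = to (proj₂ isGraph x q) h λ { (c , st , m) →
        leastCut st m r r<q r∈Q λ y s y<x n → ct y s y<x (∈ᶠ⇒↦ st n) }

      -- That every r < n has a preimage is a bounded quantifier over a Σ⁰₁ statement. Collecting
      -- the witnesses in one finite set c makes it Σ⁰₁, fit for induction, and supplies the finite
      -- sets that `between` separates.
      record Covers (c n : N) : Set where
        field
          sub  : ∀ {x r} → x ↦ r ∈ᶠ c → x ↦ r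
          onto : ∀ r → r < n → r ∈ Q → ∃ᶜ[ y ] (y ↦ r ∈ᶠ c)

      -- The roles of S and Q are exchanged: the values r have smaller code than q, while their
      -- preimages y may have any code relative to x.
      DualCut : N → N → N → Set
      DualCut c q x = ∀ y r → r < q → y ↦ r ∈ᶠ c → (r ≺ q → y ≺ x) × (q ≺ r → x ≺ y)

      dualCut-exists : ∀ {c q} → Covers c q → q ∈ Q → ∃ᶜ[ x ] (x ∈ S × DualCut c q x)
      dualCut-exists {c} {q} cov q∈Q = do
        A , hA ← comprehension (`∃< v3 ∙ ((`⟨ `⟨ v2 , v0 ⟩ , v3 ⟩ `∈ zero) `∧ (`⟨ v0 , v4 ⟩ `∈ suc zero)))
                   (c ∷ q ∷ []) (E ∷ L ∷ [])
        B , hB ← comprehension (`∃< v3 ∙ ((`⟨ `⟨ v2 , v0 ⟩ , v3 ⟩ `∈ zero) `∧ (`⟨ v4 , v0 ⟩ `∈ suc zero)))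
                   (c ∷ q ∷ []) (E ∷ L ∷ [])
        x , x∈S , A≺x , x≺B ← S.between A B c
          (λ y y∈A → ∈-stable _ _ (to (hA y) y∈A >>= λ { (_ , _ , m , _) → return (↦-source (sub m)) })
                   , <-stable _ _ (to (hA y) y∈A >>= λ { (_ , _ , m , _) → return (proj₁ (↦∈ᶠ⇒< m)) }))
          (λ y y∈B → ∈-stable _ _ (to (hB y) y∈B >>= λ { (_ , _ , m , _) → return (↦-source (sub m)) })
                   , <-stable _ _ (to (hB y) y∈B >>= λ { (_ , _ , m , _) → return (proj₁ (↦∈ᶠ⇒< m)) }))
          (λ y y′ y∈A y′∈B → ∈-stable _ _ do
            r , _ , m , r≺q ← to (hA y) y∈A
            r′ , _ , m′ , q≺r′ ← to (hB y′) y′∈B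
            return (↦-reflects (sub m) (sub m′) (Q.≺-trans r≺q q≺r′)))
        return (x , x∈S , λ y r r<q m →
            (λ r≺q → A≺x y (from (hA y) (return (r , r<q , m , r≺q))))
          , (λ q≺r → x≺B y (from (hB y) (return (r , r<q , m , q≺r)))))
        where open Covers cov

      -- The code-least x in the cut dual to q is sent to q: by leastness of x, every earlier y ∈ S
      -- is separated from x by some value below q, so q was an admissible value for x.
      hit : ∀ {c q} → Covers c q → q ∈ Q → ∃ᶜ[ x ] (x ↦ q)
      hit {c} {q} cov q∈Q missed = run do
        X , hX ← comprehension ((v1 `∈ suc (suc zero)) `∧
          (`∀< v2 ∙ (`∀< v4 ∙ ((`⟨ `⟨ v1 , v0 ⟩ , v4 ⟩ `∈ zero) `⇒
            (((`⟨ v0 , v5 ⟩ `∈ suc zero) `⇒ (`⟨ v1 , v3 ⟩ `∈ suc zero)) `∧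
             ((`⟨ v5 , v0 ⟩ `∈ suc zero) `⇒ (`⟨ v3 , v1 ⟩ `∈ suc zero)))))))
          (c ∷ q ∷ []) (E ∷ L ∷ S ∷ [])
        let intro : ∀ {x} → x ∈ S → DualCut c q x → x ∈ X
            intro x∈S dc = from (hX _) (x∈S , λ y _ r r<q m → dc y r r<q m)
        x₀ , x₀∈S , dc₀ ← dualCut-exists cov q∈Q
        x , x∈X , below ← least X x₀ (intro x₀∈S dc₀)
        let x∈S , hx = to (hX x) x∈X
            dc : DualCut c q x
            dc y r r<q m = hx y (proj₁ (↦∈ᶠ⇒< m)) r r<q m
        q′ , x↦q′ ← ↦-total x∈S
        lt q<q′ ← <-tri q q′ where
          eq refl → ⊥-elim (missed (x , x↦q′))
          -- Then x itself is the listed preimage of q′, and the dual cut would place x strictly on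
          -- one side of itself.
          gt q′<q → do
            y , m ← onto q′ q′<q (↦-target x↦q′)
            let x↦ : x ↦ q′ ∈ᶠ c
                x↦ = subst (λ t → t ↦ q′ ∈ᶠ c) (↦-injective (sub m) x↦q′) m
            Q.total (↦-target x↦q′) q∈Q >>= λ
              { (inj₁ q′≺q) → ⊥-elim (S.irrefl x (proj₁ (dc x q′ q′<q x↦) q′≺q))
              ; (inj₂ (inj₁ refl)) → ⊥-elim (<-irrefl q′<q)
              ; (inj₂ (inj₂ q≺q′)) → ⊥-elim (S.irrefl x (proj₂ (dc x q′ q′<q x↦) q≺q′)) }
        let sameSide : ∀ y s → y < x → y ↦ s → ¬ ¬ ((y ≺ x × s ≺ q) ⊎ (x ≺ y × q ≺ s))
            sameSide y s y<x y↦s = <-tri s q >>= λ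
              { (lt s<q) → do
                  y′ , m ← onto s s<q (↦-target y↦s)
                  let y↦ : y ↦ s ∈ᶠ c
                      y↦ = subst (λ t → t ↦ s ∈ᶠ c) (↦-injective (sub m) y↦s) m
                  Q.total (↦-target y↦s) q∈Q >>= λ
                    { (inj₁ s≺q) → return (inj₁ (proj₁ (dc y s s<q y↦) s≺q , s≺q))
                    ; (inj₂ (inj₁ refl)) → ⊥-elim (<-irrefl s<q)
                    ; (inj₂ (inj₂ q≺s)) → return (inj₂ (proj₂ (dc y s s<q y↦) q≺s , q≺s)) }
              ; (eq refl) → ⊥-elim (missed (y , y↦s))
              -- If y and s are not on the same side, y also lies in the dual cut: a listed y′
              -- between y and x would carry its own side over to y and s. As y < x, this
              -- contradicts the leastness of x.
              ; (gt q<s) → λ no → below y y<x (intro (↦-source y↦s) λ y′ r r<q m →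
                  let y∈S  = ↦-source y↦s
                      y′∈S = ↦-source (sub m)
                      r≢s : r ≢ s
                      r≢s r≡s = <-irrefl (<-trans q<s (subst (_< q) r≡s r<q))
                  in (λ r≺q → ∈-stable _ _ (S.total y′∈S y∈S >>= λ
                       { (inj₁ y′≺y) → return y′≺y
                       ; (inj₂ (inj₁ refl)) → ⊥-elim (r≢s (↦-functional (sub m) y↦s))
                       ; (inj₂ (inj₂ y≺y′)) → ⊥-elim (no (inj₁
                           ( S.≺-trans y≺y′ (proj₁ (dc y′ r r<q m) r≺q)
                           , Q.≺-trans (↦-mono y↦s (sub m) y≺y′) r≺q))) }))
                   , (λ q≺r → ∈-stable _ _ (S.total y∈S y′∈S >>= λ
                       { (inj₁ y≺y′) → return y≺y′
                       ; (inj₂ (inj₁ refl)) → ⊥-elim (r≢s (↦-functional (sub m) y↦s))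
                       ; (inj₂ (inj₂ y′≺y)) → ⊥-elim (no (inj₂
                           ( S.≺-trans (proj₂ (dc y′ r r<q m) q≺r) y′≺y
                           , Q.≺-trans q≺r (↦-mono (sub m) y↦s y′≺y)))) }))) }
        -- So q fits the cut of x and has smaller code than the value q′ chosen there.
        ⊥-elim (↦-least x↦q′ q q<q′ q∈Q λ y s y<x y↦s →
            (λ y≺x → ∈-stable _ _ (sameSide y s y<x y↦s >>= λ
              { (inj₁ (_ , s≺q)) → return s≺q ; (inj₂ (x≺y , _)) → ⊥-elim (S.≺-asym x≺y y≺x) }))
          , (λ x≺y → ∈-stable _ _ (sameSide y s y<x y↦s >>= λ
              { (inj₁ (y≺x , _)) → ⊥-elim (S.≺-asym x≺y y≺x) ; (inj₂ (_ , q≺s)) → return q≺s })))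
        where open Covers cov

      -- Coverage below n is exactly what `hit` needs to find a preimage of n, and the resulting
      -- pair is adjoined to c.
      covers : ∀ n → ∃ᶜ[ c ] Covers c n
      covers n = do
        c , sub , onto ← Σ⁰₁-induction
          ((`∀< v0 ∙ ((`⟨ v0 , v1 ⟩ `∈ zero) `⇒ (v0 `∈ suc zero))) `∧
           (`∀< v1 ∙ ((v0 `∈ suc (suc zero)) `⇒ (`∃< v1 ∙ (`⟨ `⟨ v0 , v1 ⟩ , v2 ⟩ `∈ zero)))))
          [] (E ∷ G ∷ Q ∷ [])
          (empty >>= λ { (c , ∅) → return (c , (λ p _ m → ⊥-elim (∅ p m)) , λ r r<0 → ⊥-elim (≮0 r r<0)) })
          (λ n h → do
            c , sub , onto ← h
            inj₁ n∈Q ← em (n ∈ Q) where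
              inj₂ n∉Q → return (c , sub , λ r r<sn r∈Q → <suc⇒ r<sn >>= λ
                { (inj₁ r<n) → onto r r<n r∈Q ; (inj₂ refl) → ⊥-elim (n∉Q r∈Q) })
            x , x↦n ← hit {c} (record
              { sub = λ m → sub _ (∈⇒< m) m
              ; onto = λ r r<n r∈Q → onto r r<n r∈Q >>= λ { (y , _ , m) → return (y , m) } }) n∈Q
            c′ , h′ ← adjoin c ⟨ x , n ⟩
            return (c′
              , (λ p _ p∈c′ → ∈-stable _ _ (to (h′ p) p∈c′ >>= λ
                  { (inj₁ p∈c) → return (sub p (∈⇒< p∈c) p∈c) ; (inj₂ refl) → return x↦n }))
              , λ r r<sn r∈Q → <suc⇒ r<sn >>= λ
                  { (inj₁ r<n) → onto r r<n r∈Q >>= λ { (y , _ , m) →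
                      let m′ = from (h′ _) (return (inj₁ m)) in return (y , proj₁ (↦∈ᶠ⇒< m′) , m′) }
                  ; (inj₂ refl) →
                      let m′ = from (h′ _) (return (inj₂ refl)) in return (x , proj₁ (↦∈ᶠ⇒< m′) , m′) }))
          n
        return (c , record
          { sub = λ m → sub _ (∈⇒< m) m
          ; onto = λ r r<n r∈Q → onto r r<n r∈Q >>= λ { (y , _ , m) → return (y , m) } })

      ↦-surjective : ∀ {q} → q ∈ Q → ∃ᶜ[ x ] (x ↦ q)
      ↦-surjective {q} q∈Q = covers q >>= λ { (c , cov) → hit cov q∈Q }

-- The refined colouring and the case distinction

module ErdősRado (M : L₂-Structure) (rca : RCA₀ M) where
  open Arithmetic M rca
  open Comprehension M rca
  open Rationals M rca
  open FiniteSetCodes M rca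
  open Orders M rca
  open ForthMap M rca
  open Principles M hiding (⟨_,_⟩; DT²₄,₂; ER²)

  pigeonhole : ∀ {a b x y z : N} → x ≢ y → x ≢ z → y ≢ z →
    x ≡ a ∨ x ≡ b → y ≡ a ∨ y ≡ b → z ≡ a ∨ z ≡ b → ⊥
  pigeonhole x≢y x≢z y≢z hx hy hz = hx λ x∈ → hy λ y∈ → hz λ z∈ → go x∈ y∈ z∈
    where
    go : _ → _ → _ → ⊥
    go (inj₁ refl) (inj₁ refl) _           = x≢y refl
    go (inj₁ refl) (inj₂ _)    (inj₁ refl) = x≢z refl
    go (inj₁ _)    (inj₂ refl) (inj₂ refl) = y≢z refl
    go (inj₂ refl) (inj₂ refl) _           = x≢y refl
    go (inj₂ refl) (inj₁ _)    (inj₂ refl) = x≢z refl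
    go (inj₂ _)    (inj₁ refl) (inj₁ refl) = y≢z refl

  <2⇒ : ∀ {e} → e < numeral 2 → ¬ ¬ (e ≡ numeral 0 ⊎ e ≡ numeral 1)
  <2⇒ e<2 = <suc⇒ e<2 >>= λ
    { (inj₂ p) → return (inj₂ p)
    ; (inj₁ e<1) → <suc⇒ e<1 >>= λ
      { (inj₁ e<0) → ⊥-elim (≮0 _ e<0)
      ; (inj₂ p) → return (inj₁ p) } }

  -- Keeps the colours 0 and 1 of agreeing pairs apart from the shifted colours of disagreeing
  -- pairs.
  <2⇒≢+2 : ∀ {e} e′ → e < numeral 2 → e ≢ (e′ + 1#) + 1#
  <2⇒≢+2 e′ e<2 refl = <2⇒ e<2 λ
    { (inj₁ p) → suc≢0 _ p
    ; (inj₂ p) → suc≢0 _ (suc-inj _ _ p) }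

  0≢1 : numeral 0 ≢ numeral 1
  0≢1 p = suc≢0 _ (sym p)

  module _ {Q L E : 𝒮} (hQ : ∀ q → (q ∈ Q) ⇔ Isℚ q) (hL : ∀ x y → (⟨ x , y ⟩ ∈ L) ⇔ (x <ℚ y))
           (fm : IsFiniteMembership E) where

    <ℚ-isStrictOrder : IsStrictOrder L
    <ℚ-isStrictOrder = record
      { irrefl = λ x p → <ℚ-irrefl x (to (hL x x) p)
      ; ≺-trans = λ p q → from (hL _ _) (<ℚ-trans (to (hL _ _) p) (to (hL _ _) q)) }

    ℚ-isDLO : IsDLO L Q
    ℚ-isDLO = record
      { isStrictOrder = <ℚ-isStrictOrder
      ; total = λ x∈Q y∈Q → ℚ-total (to (hQ _) x∈Q) (to (hQ _) y∈Q) >>= λ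
          { (inj₁ p) → return (inj₁ (from (hL _ _) p))
          ; (inj₂ (inj₁ p)) → return (inj₂ (inj₁ p))
          ; (inj₂ (inj₂ p)) → return (inj₂ (inj₂ (from (hL _ _) p))) }
      ; nonempty = ℚ-nonempty >>= λ { (q , q∈ℚ) → return (q , from (hQ q) q∈ℚ) }
      ; dense = λ _ _ p → ℚ-dense (to (hL _ _) p) >>= λ
          { (z , z∈ℚ , l , r) → return (z , from (hQ z) z∈ℚ , from (hL _ _) l , from (hL _ _) r) }
      ; noLeast = λ x∈Q → ℚ-noLeast (to (hQ _) x∈Q) >>= λ
          { (y , y∈ℚ , l) → return (y , from (hQ y) y∈ℚ , from (hL _ _) l) }
      ; noGreatest = λ x∈Q → ℚ-noGreatest (to (hQ _) x∈Q) >>= λ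
          { (y , y∈ℚ , l) → return (y , from (hQ y) y∈ℚ , from (hL _ _) l) } }

    isDLO : ∀ {S} → IsDenseLinearOrderWithoutEndpoints S → IsDLO L S
    isDLO dlo = record
      { isStrictOrder = <ℚ-isStrictOrder
      ; total = λ x∈S y∈S → total _ _ x∈S y∈S >>= λ
          { (inj₁ p) → return (inj₁ (from (hL _ _) p))
          ; (inj₂ h) → h >>= λ
            { (inj₁ p) → return (inj₂ (inj₁ p))
            ; (inj₂ p) → return (inj₂ (inj₂ (from (hL _ _) p))) } }
      ; nonempty = nonempty
      ; dense = λ x∈S y∈S p → dense _ _ x∈S y∈S (to (hL _ _) p) >>= λ
          { (z , z∈S , l , r) → return (z , z∈S , from (hL _ _) l , from (hL _ _) r) }
      ; noLeast = λ x∈S → noLeast _ x∈S >>= λ { (y , y∈S , l) → return (y , y∈S , from (hL _ _) l) }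
      ; noGreatest = λ x∈S → noGreatest _ x∈S >>= λ { (y , y∈S , l) → return (y , y∈S , from (hL _ _) l) } }
      where open IsDenseLinearOrderWithoutEndpoints dlo

    hasOrderTypeℚ : ∀ {S} → IsDLO L S → HasOrderTypeℚ S
    hasOrderTypeℚ {S} dloS = graph fm dloS ℚ-isDLO >>= λ { (G , isGraph) →
      let open Graph fm dloS ℚ-isDLO isGraph in return (G , record
      { isFunction =
          (λ p p∈G → do
            x , h ← proj₁ isGraph p p∈G
            q , refl ← h
            return (x , return (q , ↦-source p∈G , to (hQ q) (↦-target p∈G) , refl)))
        , (λ x x∈S → do
            q , x↦q ← ↦-total x∈S
            return (q , x↦q , λ q′ x↦q′ → ↦-functional x↦q′ x↦q))
      ; injective = λ x x′ q → ↦-injective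
      ; surjective = λ q q∈ℚ → do
          x , x↦q ← ↦-surjective (from (hQ q) q∈ℚ)
          return (x , ↦-source x↦q , x↦q)
      ; order = λ x x′ q q′ x↦q x′↦q′ → mk⇔
          (λ l → to (hL _ _) (↦-mono x↦q x′↦q′ (from (hL _ _) l)))
          (λ l → to (hL _ _) (↦-reflects x↦q x′↦q′ (from (hL _ _) l))) }) }

    module Refinement {F : 𝒮} (colF : IsColouring 2 F) where

      F-range : ∀ {p e} → ⟨ p , e ⟩ ∈ F → e < numeral 2
      F-range h = <-stable _ _ do
        _ , r ← proj₁ colF _ h
        b , _ , b<2 , e ← r
        return (subst (_< numeral 2) (sym (proj₂ (⟨,⟩-injective e))) b<2)

      F-value : ∀ {x y} → Isℚ x → Isℚ y → x <ℚ y → ∃!ᶜ λ e → ⟨ ⟨ x , y ⟩ , e ⟩ ∈ F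
      F-value x∈ℚ y∈ℚ x<y = proj₂ colF _ (return (_ , return (_ , x∈ℚ , y∈ℚ , x<y , refl)))

      F-two : ∀ {x y} → Isℚ x → Isℚ y → x <ℚ y →
        ¬ ¬ (⟨ ⟨ x , y ⟩ , numeral 0 ⟩ ∈ F ⊎ ⟨ ⟨ x , y ⟩ , numeral 1 ⟩ ∈ F)
      F-two x∈ℚ y∈ℚ x<y = F-value x∈ℚ y∈ℚ x<y >>= λ { (e , h , _) → <2⇒ (F-range h) >>= λ
        { (inj₁ refl) → return (inj₁ h) ; (inj₂ refl) → return (inj₂ h) } }

      -- Sierpiński's colouring joined to F: the colour is that of F, increased by 2 on the pairs
      -- on which <ℚ disagrees with the order of the codes.
      Refined : N → N → N → Set
      Refined x y c = x ∈ Q × y ∈ Q × ⟨ x , y ⟩ ∈ L ×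
        ((x < y × ⟨ ⟨ x , y ⟩ , c ⟩ ∈ F)
          ∨ (y < x × (∃ᶜ[ e ] (e < c × c ≡ (e + 1#) + 1# × ⟨ ⟨ x , y ⟩ , e ⟩ ∈ F))))

      IsRefinement : 𝒮 → Set
      IsRefinement H = ∀ x y c → (⟨ ⟨ x , y ⟩ , c ⟩ ∈ H) ⇔ Refined x y c

      refinement : ∃ᶜ[ H ] (IsColouring 4 H × IsRefinement H)
      refinement = do
        H , triple , h ← comprehension₃
          ((v2 `∈ suc (suc zero)) `∧ ((v1 `∈ suc (suc zero)) `∧ ((`⟨ v2 , v1 ⟩ `∈ suc zero) `∧
            (((v2 `< v1) `∧ (`⟨ `⟨ v2 , v1 ⟩ , v0 ⟩ `∈ zero)) `∨
             ((v1 `< v2) `∧ (`∃< v0 ∙ ((v1 `= ((v0 `+ `1) `+ `1)) `∧ (`⟨ `⟨ v3 , v2 ⟩ , v0 ⟩ `∈ zero))))))))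
          [] (F ∷ L ∷ Q ∷ [])
        return (H
          , ( (λ p p∈H → do
                x , r ← triple p p∈H
                y , r ← r
                c , refl ← r
                let x∈Q , y∈Q , x≺y , r = to (h x y c) p∈H
                return (⟨ x , y ⟩ , return (c
                  , return (x , return (y , to (hQ x) x∈Q , to (hQ y) y∈Q , to (hL x y) x≺y , refl))
                  , <-stable _ _ (r >>= λ
                    { (inj₁ (_ , m)) → return (<⇒<suc (<⇒<suc (F-range m)))
                    ; (inj₂ (_ , s)) → s >>= λ { (e , _ , refl , m) →
                        return (suc-mono-< (suc-mono-< (F-range m))) } })
                  , refl)))
            , λ a a∈ → do
                x , r ← a∈
                y , x∈ℚ , y∈ℚ , x<y , refl ← r
                e , m , uniq ← F-value x∈ℚ y∈ℚ x<y
                <-tri x y >>= λ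
                  { (lt l) → return (e
                      , from (h x y e) (from (hQ x) x∈ℚ , from (hQ y) y∈ℚ , from (hL x y) x<y , return (inj₁ (l , m)))
                      , λ c m′ → ≡-stable _ _ (proj₂ (proj₂ (proj₂ (to (h x y c) m′))) >>= λ
                          { (inj₁ (_ , n)) → return (uniq c n)
                          ; (inj₂ (g , _)) → ⊥-elim (<-irrefl (<-trans l g)) }))
                  ; (eq refl) → ⊥-elim (<ℚ-irrefl x x<y)
                  ; (gt g) → return ((e + 1#) + 1#
                      , from (h x y _) (from (hQ x) x∈ℚ , from (hQ y) y∈ℚ , from (hL x y) x<y
                        , return (inj₂ (g , return (e , <⇒<suc (n<n+1 e) , refl , m))))
                      , λ c m′ → ≡-stable _ _ (proj₂ (proj₂ (proj₂ (to (h x y c) m′))) >>= λ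
                          { (inj₁ (l , _)) → ⊥-elim (<-irrefl (<-trans l g))
                          ; (inj₂ (_ , s)) → s >>= λ { (e′ , _ , refl , n) →
                              return (cong (λ t → (t + 1#) + 1#) (uniq e′ n)) } })) } )
          , h)

      module TwoColours {H S : 𝒮} (isRef : IsRefinement H) (S⊆ℚ : S ⊆ℚ) (dloS : IsDLO L S) {a b : N}
             (two : ∀ x y → x ∈ S → y ∈ S → x <ℚ y → ∀ c → ⟨ ⟨ x , y ⟩ , c ⟩ ∈ H → c ≡ a ∨ c ≡ b) where
        open IsDLO dloS

        Conclusion : Set
        Conclusion = ∃ᶜ[ T ] (T ⊆ℚ × ((IsInfinite T × IsConstantly 0 F T)
                                      ∨ (HasOrderTypeℚ T × IsConstantly 1 F T)))

        Agreeing Disagreeing : N → N → N → Set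
        Agreeing    x y e = x ∈ S × y ∈ S × x <ℚ y × x < y × ⟨ ⟨ x , y ⟩ , e ⟩ ∈ F
        Disagreeing x y e = x ∈ S × y ∈ S × x <ℚ y × y < x × ⟨ ⟨ x , y ⟩ , e ⟩ ∈ F

        agreeing-colour : ∀ {x y e} → Agreeing x y e → e ≡ a ∨ e ≡ b
        agreeing-colour (x∈S , y∈S , x<y , l , m) = two _ _ x∈S y∈S x<y _ (from (isRef _ _ _)
          (from (hQ _) (S⊆ℚ _ x∈S) , from (hQ _) (S⊆ℚ _ y∈S) , from (hL _ _) x<y , return (inj₁ (l , m))))

        disagreeing-colour : ∀ {x y e} → Disagreeing x y e → (e + 1#) + 1# ≡ a ∨ (e + 1#) + 1# ≡ b
        disagreeing-colour {e = e} (x∈S , y∈S , x<y , g , m) = two _ _ x∈S y∈S x<y _ (from (isRef _ _ _)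
          (from (hQ _) (S⊆ℚ _ x∈S) , from (hQ _) (S⊆ℚ _ y∈S) , from (hL _ _) x<y
          , return (inj₂ (g , return (e , <⇒<suc (n<n+1 e) , refl , m)))))

        conclusion : Conclusion
        conclusion = do
          Lᵒ , hᵒ ← opposite L
          T , hT , T-inf ← records isStrictOrder total nonempty noGreatest
          Tᵒ , hTᵒ , Tᵒ-inf ← records (opposite-isStrictOrder hᵒ isStrictOrder) (opposite-total hᵒ {S} total) nonempty
            (λ x∈S → noLeast x∈S >>= λ { (y , y∈S , l) → return (y , y∈S , from (hᵒ _ _) l) })
          let T⊆S : ∀ {x} → x ∈ T → x ∈ S
              T⊆S x∈T = proj₁ (to (hT _) x∈T)
              Tᵒ⊆S : ∀ {x} → x ∈ Tᵒ → x ∈ S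
              Tᵒ⊆S x∈T = proj₁ (to (hTᵒ _) x∈T)
          -- Two elements of each record set exhibit one agreeing and one disagreeing pair.
          u , _ , u∈T ← T-inf 0#
          v , u<v , v∈T ← T-inf u
          uᵒ , _ , uᵒ∈T ← Tᵒ-inf 0#
          vᵒ , uᵒ<vᵒ , vᵒ∈T ← Tᵒ-inf uᵒ
          let u≺v = to (hL _ _) (proj₂ (to (hT v) v∈T) u u<v (T⊆S u∈T))
              vᵒ≺uᵒ = to (hL _ _) (to (hᵒ _ _) (proj₂ (to (hTᵒ vᵒ) vᵒ∈T) uᵒ uᵒ<vᵒ (Tᵒ⊆S uᵒ∈T)))
          e , m , _ ← F-value (S⊆ℚ _ (T⊆S u∈T)) (S⊆ℚ _ (T⊆S v∈T)) u≺v
          eᵒ , mᵒ , _ ← F-value (S⊆ℚ _ (Tᵒ⊆S vᵒ∈T)) (S⊆ℚ _ (Tᵒ⊆S uᵒ∈T)) vᵒ≺uᵒ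
          let e-col = agreeing-colour (T⊆S u∈T , T⊆S v∈T , u≺v , u<v , m)
              eᵒ-col = disagreeing-colour (Tᵒ⊆S vᵒ∈T , Tᵒ⊆S uᵒ∈T , vᵒ≺uᵒ , uᵒ<vᵒ , mᵒ)
          -- A 0-coloured agreeing pair anywhere in S makes 0 the only colour of agreeing pairs,
          -- hence of all pairs from T.
          inj₂ no-agreeing-0 ← em (Σ N λ x → Σ N λ y → Agreeing x y (numeral 0)) where
            inj₁ (x , y , ag) → return (T , (λ x x∈T → S⊆ℚ x (T⊆S x∈T)) , return (inj₁ (T-inf
              , λ x′ y′ x′∈T y′∈T x′<y′ → ∈-stable _ _ do
                  inj₂ m₁ ← F-two (S⊆ℚ _ (T⊆S x′∈T)) (S⊆ℚ _ (T⊆S y′∈T)) x′<y′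
                    where inj₁ m₀ → return m₀
                  lt l ← <-tri x′ y′ where
                    eq refl → ⊥-elim (<ℚ-irrefl x′ x′<y′)
                    gt g → ⊥-elim (≺-asym (from (hL _ _) x′<y′) (proj₂ (to (hT x′) x′∈T) y′ g (T⊆S y′∈T)))
                  -- Otherwise 0, 1 and eᵒ + 2 would be three distinct colours among a and b.
                  ⊥-elim (pigeonhole 0≢1 (<2⇒≢+2 eᵒ (<⇒<suc (n<n+1 _))) (<2⇒≢+2 eᵒ (n<n+1 _))
                    (agreeing-colour ag)
                    (agreeing-colour (T⊆S x′∈T , T⊆S y′∈T , x′<y′ , l , m₁))
                    eᵒ-col))))
          inj₂ no-disagreeing-0 ← em (Σ N λ x → Σ N λ y → Disagreeing x y (numeral 0)) where
            inj₁ (x , y , dis) → return (Tᵒ , (λ x x∈T → S⊆ℚ x (Tᵒ⊆S x∈T)) , return (inj₁ (Tᵒ-inf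
              , λ x′ y′ x′∈T y′∈T x′<y′ → ∈-stable _ _ do
                  inj₂ m₁ ← F-two (S⊆ℚ _ (Tᵒ⊆S x′∈T)) (S⊆ℚ _ (Tᵒ⊆S y′∈T)) x′<y′
                    where inj₁ m₀ → return m₀
                  gt g ← <-tri x′ y′ where
                    eq refl → ⊥-elim (<ℚ-irrefl x′ x′<y′)
                    lt l → ⊥-elim (≺-asym (from (hL _ _) x′<y′)
                      (to (hᵒ _ _) (proj₂ (to (hTᵒ y′) y′∈T) x′ l (Tᵒ⊆S x′∈T))))
                  -- Here the three distinct colours are e, 2 and 3.
                  ⊥-elim (pigeonhole (<2⇒≢+2 (numeral 0) (F-range m)) (<2⇒≢+2 (numeral 1) (F-range m))
                    (λ p → 0≢1 (suc-inj _ _ (suc-inj _ _ p)))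
                    e-col
                    (disagreeing-colour dis)
                    (disagreeing-colour (Tᵒ⊆S x′∈T , Tᵒ⊆S y′∈T , x′<y′ , g , m₁))))))
          return (S , S⊆ℚ , return (inj₂ (hasOrderTypeℚ dloS , λ x y x∈S y∈S x<y → ∈-stable _ _ do
            inj₁ m₀ ← F-two (S⊆ℚ _ x∈S) (S⊆ℚ _ y∈S) x<y where inj₂ m₁ → return m₁
            <-tri x y >>= λ
              { (lt l) → ⊥-elim (no-agreeing-0 (x , y , x∈S , y∈S , x<y , l , m₀))
              ; (eq refl) → ⊥-elim (<ℚ-irrefl x x<y)
              ; (gt g) → ⊥-elim (no-disagreeing-0 (x , y , x∈S , y∈S , x<y , g , m₀)) })))

  DT⇒ER : DT²₄,₂ M → ER² M
  DT⇒ER DT F colF = do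
    Q , hQ ← ℚ-set
    L , hL ← <ℚ-set
    E , fm ← finiteMembership
    H , colH , isRef ← Refinement.refinement hQ hL fm colF
    S , S⊆ℚ , dlo , cols ← DT H colH
    a , cols ← cols
    b , two ← cols
    Refinement.TwoColours.conclusion hQ hL fm colF isRef S⊆ℚ (isDLO hQ hL fm dlo) two

theorem5p44 : DT²₄,₂ ⇒[RCA₀] ER²
theorem5p44 = ErdősRado.DT⇒ER
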